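{- Let $k$ be a fixed positive integer. There is an algorithm which, given as input a $k$-degenerate graph $G$, computes the neighborhood polynomial $N(G,x)$ (i.e. all of its coefficients) in time polynomial in the size of $G$.
   Context: All graphs are simple, finite and undirected. For a graph $G=(V,E)$ and $v\in V$, $N_G(v)=\{u\in V: \{u,v\}\in E\}$ is the open neighborhood of $v$. The neighborhood complex of $G$ is $\mathcal N(G)=\{A\subseteq V : \exists v\in V,\ A\subseteq N_G(v)\}$, and the neighborhood polynomial of $G$ is $N(G,x)=\sum_{A\in\mathcal N(G)}x^{|A|}$. A graph $G$ of order $n$ is $k$-degenerate ($0<k<n$) if every non-empty subgraph of $G$, including $G$ itself, has at least one vertex of degree at most $k$ (in that subgraph). The integer $k$ is a constant: the polynomial bounding the running time may depend on $k$. -}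

module Defs where

open import Data.Bool.Base using (Bool; true; false)
open import Data.Bool.Properties as Bool using ()
open import Data.Digit using (Bit; Expansion; fromDigits)
open import Data.Fin.Base using (Fin; zero; suc; fromℕ<)
open import Data.Fin.Properties using (any?; _<?_)
open import Data.Fin.Subset
  using (Subset; inside; outside; _∈_; _⊆_; ∣_∣; Nonempty)
open import Data.Fin.Subset.Properties using (_⊆?_; ∣p∣≤n)
open import Data.List.Base
  using (List; []; _∷_; _++_; map; foldr; filter; length; allFin; cartesianProduct)
open import Data.Nat.Base as ℕ using (ℕ; zero; suc; _+_; _≤_; s≤s)
open import Data.Product.Base using (Σ-syntax; ∃-syntax; _×_; _,_)
open import Data.Vec.Base as Vec
  using (Vec; tabulate; replicate; lookup; zipWith; toList; _[_]≔_)
  renaming ([] to []ᵛ; _∷_ to _∷ᵛ_)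
open import Relation.Binary.PropositionalEquality using (_≡_; _≢_)
open import Relation.Nullary.Decidable using (Dec; _×-dec_)

record Graph : Set where
  field
    order  : ℕ
    adj    : Fin order → Fin order → Bool
    sym    : ∀ u v → adj u v ≡ adj v u
    irrefl : ∀ v → adj v v ≡ false

  nbhd : Fin order → Subset order
  nbhd v = tabulate (adj v)

  edges : List (Fin order × Fin order)
  edges = filter (λ (u , v) → (u <? v) ×-dec (adj u v Bool.≟ true))
                 (cartesianProduct (allFin order) (allFin order))

  size : ℕ
  size = order + length edges

open Graph public using (order; size)

-- A subgraph may omit edges as well as vertices.
record Subgraph (G : Graph) : Set where
  open Graph G using (adj)
  field
    verts     : Subset (order G)
    adjˢ      : Fin (order G) → Fin (order G) → Bool
    symˢ      : ∀ u v → adjˢ u v ≡ adjˢ v u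
    adjˢ⊆adj  : ∀ u v → adjˢ u v ≡ true → adj u v ≡ true
    endpoints : ∀ u v → adjˢ u v ≡ true → u ∈ verts × v ∈ verts

  degree : Fin (order G) → ℕ
  degree v = ∣ tabulate (adjˢ v) ∣

record Degenerate (k : ℕ) (G : Graph) : Set where
  field
    0<k       : 0 ℕ.< k
    k<n       : k ℕ.< order G
    lowDegree : (H : Subgraph G) → let open Subgraph H in
                Nonempty verts → ∃[ v ] v ∈ verts × degree v ≤ k

InNbhdComplex : (G : Graph) → Subset (order G) → Set
InNbhdComplex G A = ∃[ v ] A ⊆ Graph.nbhd G v

inNbhdComplex? : (G : Graph) (A : Subset (order G)) → Dec (InNbhdComplex G A)
inNbhdComplex? G A = any? (λ v → A ⊆? Graph.nbhd G v)

subsets : (n : ℕ) → List (Subset n)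
subsets zero    = []ᵛ ∷ []
subsets (suc n) = map (outside ∷ᵛ_) (subsets n) ++ map (inside ∷ᵛ_) (subsets n)

-- Polynomials of degree less than m over ℕ, as coefficient vectors with the
-- constant term first.
Poly : ℕ → Set
Poly m = Vec ℕ m

x^_ : ∀ {m} → Fin m → Poly m
x^ i = replicate _ 0 [ i ]≔ 1

sumPoly : ∀ {m} → List (Poly m) → Poly m
sumPoly = foldr (zipWith _+_) (replicate _ 0)

nbhdPoly : (G : Graph) → Poly (suc (order G))
nbhdPoly G = sumPoly (map (λ A → x^ (fromℕ< (s≤s (∣p∣≤n A))))
                          (filter (inNbhdComplex? G) (subsets (order G))))

-- The machine model is Jones's language WHILE (N. D. Jones, "Computability and
-- Complexity from a Programming Perspective") with the single atom nil. Every
-- elementary operation takes one unit of time and builds or inspects at most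
-- one cons cell, so that polynomial time agrees with Turing machines.
infixr 5 _∙_

data Tree : Set where
  nil : Tree
  _∙_ : Tree → Tree → Tree

head tail : Tree → Tree
head nil     = nil
head (a ∙ b) = a
tail nil     = nil
tail (a ∙ b) = b

data Expr (m : ℕ) : Set where
  var   : Fin m → Expr m
  nil   : Expr m
  cons  : Expr m → Expr m → Expr m
  hd tl : Expr m → Expr m

infixr 4 _⨾_
infix  5 _≔_

data Cmd (m : ℕ) : Set where
  _≔_      : Fin m → Expr m → Cmd m
  _⨾_      : Cmd m → Cmd m → Cmd m
  while_⟨_⟩ : Expr m → Cmd m → Cmd m

Store : ℕ → Set
Store m = Vec Tree m

eval : ∀ {m} → Expr m → Store m → Tree
eval (var x)    σ = lookup σ x
eval nil        σ = nil
eval (cons e f) σ = eval e σ ∙ eval f σ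
eval (hd e)     σ = head (eval e σ)
eval (tl e)     σ = tail (eval e σ)

cost : ∀ {m} → Expr m → ℕ
cost (var x)    = 1
cost nil        = 1
cost (cons e f) = 1 + cost e + cost f
cost (hd e)     = 1 + cost e
cost (tl e)     = 1 + cost e

-- c , σ ⇓ τ [ t ]: started in store σ, the command c halts after time t in
-- store τ.
infix 3 _,_⇓_[_]

data _,_⇓_[_] {m : ℕ} : Cmd m → Store m → Store m → ℕ → Set where
  assign : ∀ {x e σ} →
           x ≔ e , σ ⇓ σ [ x ]≔ eval e σ [ 1 + cost e ]
  seq    : ∀ {c d σ τ υ s t} →
           c , σ ⇓ τ [ s ] → d , τ ⇓ υ [ t ] →
           c ⨾ d , σ ⇓ υ [ 1 + s + t ]
  stop   : ∀ {e c σ} → eval e σ ≡ nil →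
           while e ⟨ c ⟩ , σ ⇓ σ [ 1 + cost e ]
  loop   : ∀ {e c σ τ υ s t} → eval e σ ≢ nil →
           c , σ ⇓ τ [ s ] → while e ⟨ c ⟩ , τ ⇓ υ [ t ] →
           while e ⟨ c ⟩ , σ ⇓ υ [ 1 + cost e + s + t ]

-- Variable zero holds the input and, at the end, the output; all other
-- variables start as nil.
record Program : Set where
  constructor program
  field
    {extraVars} : ℕ
    body        : Cmd (suc extraVars)

-- p on a gives b in-time t
infix 3 _on_gives_in-time_

_on_gives_in-time_ : Program → Tree → Tree → ℕ → Set
program c on a gives b in-time t =
  ∃[ τ ] (c , a ∷ᵛ replicate _ nil ⇓ τ [ t ]) × Vec.head τ ≡ b

encodeList : ∀ {A : Set} → (A → Tree) → List A → Tree
encodeList f []       = nil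
encodeList f (x ∷ xs) = f x ∙ encodeList f xs

encodeBool : Bool → Tree
encodeBool false = nil
encodeBool true  = nil ∙ nil

encodeBit : Bit → Tree
encodeBit zero       = nil
encodeBit (suc zero) = nil ∙ nil

-- The adjacency matrix, row by row.
encodeGraph : Graph → Tree
encodeGraph G = encodeList (λ v → encodeList encodeBool (toList (Graph.nbhd G v)))
                           (allFin (order G))

-- The tree lists all coefficients, constant term first, each in binary with
-- the least significant bit first; zeros at the most significant end are
-- allowed.
Represents : ∀ {m} → Tree → Poly m → Set
Represents {m} b p =
  Σ[ ds ∈ Vec (Expansion 2) m ]
    b ≡ encodeList (encodeList encodeBit) (toList ds)
    × Vec.map fromDigits ds ≡ p

{-# OPTIONS --safe #-}
module Submission where

-- Scan the vertices one at a time and keep a table that assigns to every common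
-- neighborhood C of a set A of scanned vertices the sum P of x^|A| over all sets
-- A with this common neighborhood. Scanning v turns (C , P) into (C , P) and
-- (C ∩ N(v) , x P), and entries with equal C are merged; in the end N(G,x) is the
-- sum of P over all C ≠ ∅. As A and C span a complete bipartite graph and
-- K_{k+1,k+1} is not k-degenerate, A or C has at most k elements, so at most
-- 2 (n+1)^k sets C occur. The coefficients are at most 2^n, hence P can be stored
-- as the single number P(2^(n+1)), whose digits in base 2^(n+1) are the
-- coefficients; addition and multiplication by x then need only binary addition
-- and shifts.

open import Defs
open import Data.Bool.Base using (Bool; true; false; not; T; _∧_; _∨_; _xor_; if_then_else_)
open import Data.Bool.Properties using (T?)
open import Data.Digit using (Bit; Expansion; fromDigits)
open import Data.Fin using (#_)
open import Data.Fin.Base using (Fin; zero; suc; toℕ; fromℕ<)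
open import Data.Fin.Patterns
open import Data.Fin.Properties using (toℕ-fromℕ<)
open import Data.Fin.Subset
  using (Subset; inside; outside; ⊤; ⊥; ⁅_⁆; _∩_; _∪_; _∈_; _⊆_; ∣_∣; Nonempty)
open import Data.Fin.Subset.Properties
  using (x∈p∩q⁺; x∈p∩q⁻; x∈p∪q⁺; x∈p∪q⁻; x∈⁅y⁆⇒x≡y; x∈⁅x⁆; ∈⊤; ∉⊥; ∣⊥∣≡0; ∣p∣≤n; _∈?_; _⊆?_;
         p⊆q⇒∣p∣≤∣q∣; ⊆-antisym; nonempty?; Empty-unique)
open import Data.List.Base as List
  using (List; []; _∷_; _++_; _ʳ++_; length; map; filter; foldl; foldr; reverse)
open import Data.List.Membership.Propositional using () renaming (_∈_ to _∈ˡ_)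
open import Data.List.Membership.Propositional.Properties using (∈-∃++; ∈-++⁺ˡ; ∈-++⁺ʳ; ∈-++⁻; ∈-map⁺)
open import Data.List.Properties
  using (length-ʳ++; length-++; length-++-sucʳ; length-filter; length-map; length-replicate; length-reverse;
         length-tabulate; map-++; map-∘; reverse-foldl)
open import Data.List.Relation.Binary.Permutation.Propositional using (↭-sym)
open import Data.List.Relation.Binary.Permutation.Propositional.Properties using (All-resp-↭; ↭-reverse)
open import Data.List.Relation.Unary.All as All using (All; []; _∷_)
import Data.List.Relation.Unary.All.Properties as All
open import Data.List.Relation.Unary.AllPairs using (AllPairs; []; _∷_)
import Data.List.Relation.Unary.AllPairs.Properties as AllPairs
open import Data.List.Relation.Unary.Any using (here; there)
open import Data.List.Relation.Unary.Unique.Propositional using (Unique)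
open import Data.Nat.Base
  using (ℕ; zero; suc; _+_; _*_; _^_; _%_; _≤_; _<_; z≤n; s≤s; NonZero; >-nonZero)
open import Data.Nat.DivMod using ([m+kn]%n≡m%n; m<n⇒m%n≡m)
open import Data.Nat.ListAction using (sum)
open import Data.Nat.ListAction.Properties using (sum-++)
open import Data.Nat.Properties
open import Data.Nat.Tactic.RingSolver using (solve-∀)
open import Data.Product.Base using (Σ-syntax; ∃-syntax; _×_; _,_; proj₁; proj₂)
open import Data.Sum.Base using (_⊎_; inj₁; inj₂; swap)
open import Data.Unit.Base using (tt)
open import Data.Vec.Base as Vec
  using (Vec; _[_]≔_; foldr′; here; there; toList; fromList; tabulate; zipWith)
  renaming ([] to []ᵛ; _∷_ to _∷ᵛ_)
open import Data.Vec.Properties using (∷-injectiveˡ; ∷-injectiveʳ; []=⇒lookup; lookup⇒[]=; lookup∘tabulate)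
open import Data.Vec.Relation.Unary.All as Allᵛ using () renaming (All to Allᵛ; [] to []ᵃ; _∷_ to _∷ᵃ_)
open import Function.Base using (_∘_; flip)
open import Function.Bundles using (mk⇔)
open import Relation.Binary.PropositionalEquality
open import Relation.Nullary.Decidable using (Dec; yes; no; does; dec-true; does-⇔; _×-dec_; _⊎-dec_)
open import Relation.Nullary.Negation using (contradiction)

-- One program serves every k; degeneracy enters through the number of sets C, which bounds the
-- length of every table. WHILE can only build trees, take them apart and test for `nil`. Therefore
-- all operations on sets and numbers are finite-state machines that run bit by bit along a ruler, a
-- list of which only the length matters. The time of such a run depends on the ruler alone, but
-- results have a fixed length and overflow must be excluded. Put B = 2^(n+1). The sum of P(B) over
-- a table never exceeds the sum of B^|A| over all sets A of vertices, which is (1+B)^n <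
-- 2^((n+1)^2). Hence rulers of length (n+1)^2 suffice for numbers. Merging changes the order and
-- the number of entries, so tables are never described explicitly. The invariants speak of the sums
-- of φ(C) P(B) for an arbitrary function φ of sets. Scanning a vertex acts on φ by a dual
-- operation. The choice φ = 1 yields the overflow bounds, and the indicator of C ≠ ∅ yields N(G,B).

private variable
  m : ℕ

-- Runs with an upper bound on their time.

infix 3 _⊢_⇒_⟪_⟫
_⊢_⇒_⟪_⟫ : Cmd m → Store m → Store m → ℕ → Set
c ⊢ σ ⇒ τ ⟪ t ⟫ = ∃[ s ] (c , σ ⇓ τ [ s ]) × s ≤ t

weaken : ∀ {c : Cmd m} {σ τ t t′} → t ≤ t′ → c ⊢ σ ⇒ τ ⟪ t ⟫ → c ⊢ σ ⇒ τ ⟪ t′ ⟫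
weaken t≤t′ (s , run , s≤t) = s , run , ≤-trans s≤t t≤t′

set : ∀ {x : Fin m} {e σ} → x ≔ e ⊢ σ ⇒ σ [ x ]≔ eval e σ ⟪ 1 + cost e ⟫
set = _ , assign , ≤-refl

setTo : ∀ {x : Fin m} {e σ v t} → eval e σ ≡ v → cost e ≤ t → x ≔ e ⊢ σ ⇒ σ [ x ]≔ v ⟪ 1 + t ⟫
setTo refl p = _ , assign , s≤s p

infixr 4 _⨟_
_⨟_ : ∀ {c d : Cmd m} {σ τ υ s t} →
      c ⊢ σ ⇒ τ ⟪ s ⟫ → d ⊢ τ ⇒ υ ⟪ t ⟫ → c ⨾ d ⊢ σ ⇒ υ ⟪ 1 + s + t ⟫
(_ , run , p) ⨟ (_ , run′ , q) = _ , seq run run′ , s≤s (+-mono-≤ p q)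

-- The store σ xs a shows the part xs of a list that is still to be visited, and
-- the other data a.
abstract
  forEach : ∀ {A X : Set} {e : Expr m} {c : Cmd m} {t} (σ : List X → A → Store m)
            (I : List X → A → Set) →
            (∀ {a} → eval e (σ [] a) ≡ nil) →
            (∀ {x xs a} → eval e (σ (x ∷ xs) a) ≢ nil) →
            (∀ {x xs a} → I (x ∷ xs) a → ∃[ b ] (c ⊢ σ (x ∷ xs) a ⇒ σ xs b ⟪ t ⟫) × I xs b) →
            ∀ xs {a} → I xs a →
            ∃[ b ] (while e ⟨ c ⟩ ⊢ σ xs a ⇒ σ [] b ⟪ length xs * (1 + cost e + t) + (1 + cost e) ⟫) × I [] b
  forEach σ I end more body [] i = _ , (_ , stop end , ≤-refl) , i
  forEach {e = e} {t = t} σ I end more body (x ∷ xs) i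
    with _ , (_ , run , p) , j ← body i
    with _ , (_ , run′ , q) , k ← forEach {e = e} σ I end more body xs j =
    _ , (_ , loop more run run′ , ≤-trans (s≤s (+-mono-≤ (+-monoʳ-≤ (cost e) p) q))
          (≤-reflexive (sym (+-assoc (1 + cost e + t) (length xs * (1 + cost e + t)) (1 + cost e))))) , k

-- Subroutines inside a larger store.

shiftE : Expr m → Expr (suc m)
shiftE (var x)    = var (suc x)
shiftE nil        = nil
shiftE (cons e f) = cons (shiftE e) (shiftE f)
shiftE (hd e)     = hd (shiftE e)
shiftE (tl e)     = tl (shiftE e)

shift : Cmd m → Cmd (suc m)
shift (x ≔ e)       = suc x ≔ shiftE e
shift (c ⨾ d)       = shift c ⨾ shift d
shift while e ⟨ c ⟩ = while shiftE e ⟨ shift c ⟩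

module _ {v : Tree} {σ : Store m} where

  eval-shiftE : ∀ e → eval (shiftE e) (v ∷ᵛ σ) ≡ eval e σ
  eval-shiftE (var x)    = refl
  eval-shiftE nil        = refl
  eval-shiftE (cons e f) = cong₂ _∙_ (eval-shiftE e) (eval-shiftE f)
  eval-shiftE (hd e)     = cong head (eval-shiftE e)
  eval-shiftE (tl e)     = cong tail (eval-shiftE e)

cost-shiftE : (e : Expr m) → cost (shiftE e) ≡ cost e
cost-shiftE (var x)    = refl
cost-shiftE nil        = refl
cost-shiftE (cons e f) = cong suc (cong₂ _+_ (cost-shiftE e) (cost-shiftE f))
cost-shiftE (hd e)     = cong suc (cost-shiftE e)
cost-shiftE (tl e)     = cong suc (cost-shiftE e)

abstract
  ⇓-shift : ∀ {c : Cmd m} {v σ τ t} → c , σ ⇓ τ [ t ] → shift c , v ∷ᵛ σ ⇓ v ∷ᵛ τ [ t ]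
  ⇓-shift {v = v} {σ = σ} (assign {e = e})
    rewrite sym (eval-shiftE {v = v} {σ = σ} e) | sym (cost-shiftE e) = assign
  ⇓-shift (seq r s) = seq (⇓-shift r) (⇓-shift s)
  ⇓-shift (stop {e = e} p)
    rewrite sym (cost-shiftE e) = stop (trans (eval-shiftE e) p)
  ⇓-shift (loop {e = e} p r s)
    rewrite sym (cost-shiftE e) = loop (λ q → p (trans (sym (eval-shiftE e)) q)) (⇓-shift r) (⇓-shift s)

-- A subroutine is written for the registers that it uses and is called on the last registers of the
-- larger store; the first `p` keep their contents.
lift : ∀ p → Cmd m → Cmd (p + m)
lift zero    c = c
lift (suc p) c = shift (lift p c)

abstract
  lifted : ∀ {p} (ρ : Store p) {c : Cmd m} {σ τ t} →
           c ⊢ σ ⇒ τ ⟪ t ⟫ → lift p c ⊢ ρ Vec.++ σ ⇒ ρ Vec.++ τ ⟪ t ⟫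
  lifted []ᵛ      r = r
  lifted (v ∷ᵛ ρ) r with s , run , p ← lifted ρ r = s , ⇓-shift run , p

-- Trees as bits, bit lists and counters.

truth : Tree → Bool
truth nil     = false
truth (_ ∙ _) = true

truth-encodeBool : ∀ b → truth (encodeBool b) ≡ b
truth-encodeBool false = refl
truth-encodeBool true  = refl

encodeBits : List Bool → Tree
encodeBits = encodeList encodeBool

-- A number in unary, whatever the entries are. In particular the adjacency matrix, as a list of
-- rows, is itself a counter for n.
spine : List Tree → Tree
spine = encodeList (λ t → t)

reverseOnto : Cmd 2
reverseOnto = while var 0F ⟨ 1F ≔ cons (hd (var 0F)) (var 1F) ⨾ 0F ≔ tl (var 0F) ⟩

abstract
  reverseOnto-runs : ∀ xs ys → reverseOnto ⊢ encodeBits xs ∷ᵛ encodeBits ys ∷ᵛ []ᵛ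
                     ⇒ nil ∷ᵛ encodeBits (xs ʳ++ ys) ∷ᵛ []ᵛ ⟪ length xs * 11 + 2 ⟫
  reverseOnto-runs xs ys
    with _ , run , refl ← forEach {e = var 0F}
      (λ xs ys → encodeBits xs ∷ᵛ encodeBits ys ∷ᵛ []ᵛ)
      (λ xs′ ys′ → xs′ ʳ++ ys′ ≡ xs ʳ++ ys)
      refl (λ ()) (λ i → _ , (set ⨟ set) , i) xs refl = run

-- On numbers, multiplication by a power of 2.
zeros : Cmd 2
zeros = while var 0F ⟨ 1F ≔ cons nil (var 1F) ⨾ 0F ≔ tl (var 0F) ⟩

nils : ℕ → Tree → Tree
nils zero    t = t
nils (suc n) t = nil ∙ nils n t

nils-suc : ∀ n t → nils n (nil ∙ t) ≡ nil ∙ nils n t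
nils-suc zero    t = refl
nils-suc (suc n) t = cong (nil ∙_) (nils-suc n t)

abstract
  zeros-runs : ∀ rs t → zeros ⊢ spine rs ∷ᵛ t ∷ᵛ []ᵛ
               ⇒ nil ∷ᵛ nils (length rs) t ∷ᵛ []ᵛ ⟪ length rs * 10 + 2 ⟫
  zeros-runs rs t
    with _ , run , refl ← forEach {e = var 0F}
      (λ rs t → spine rs ∷ᵛ t ∷ᵛ []ᵛ)
      (λ rs′ t′ → nils (length rs′) t′ ≡ nils (length rs) t)
      refl (λ ()) (λ {_} {rs′} {t′} i → _ , (set ⨟ set) , trans (nils-suc (length rs′) t′) i) rs refl = run

-- Mealy machines running along bit lists.

-- A Mealy machine: δ state bit bit = output , next state.
Machine : Set
Machine = Bool → Bool → Bool → Bool × Bool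

node : (Bool → Tree) → Tree
node f = f false ∙ f true

nodeE : (Bool → Expr m) → Expr m
nodeE f = cons (f false) (f true)

bitE : Bool → Expr m
bitE false = nil
bitE true  = cons nil nil

leaf : Bool × Bool → Tree
leaf (a , b) = encodeBool a ∙ encodeBool b

leafE : Bool × Bool → Expr m
leafE (a , b) = cons (bitE a) (bitE b)

-- The eight transitions form one constant tree that branches on the state and the two bits, so
-- three selections look up a transition.
table : Machine → Tree
table δ = node λ s → node λ a → node λ b → leaf (δ s a b)

tableE : Machine → Expr m
tableE δ = nodeE λ s → nodeE λ a → nodeE λ b → leafE (δ s a b)

module _ {σ : Store m} where

  eval-bitE : ∀ b → eval (bitE b) σ ≡ encodeBool b
  eval-bitE false = refl
  eval-bitE true  = refl

  eval-nodeE : ∀ f {g} → (∀ b → eval (f b) σ ≡ g b) → eval (nodeE f) σ ≡ node g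
  eval-nodeE f p = cong₂ _∙_ (p false) (p true)

  eval-tableE : ∀ δ → eval (tableE δ) σ ≡ table δ
  eval-tableE δ =
    eval-nodeE (λ s → nodeE λ a → nodeE λ b → leafE (δ s a b)) λ s →
    eval-nodeE (λ a → nodeE λ b → leafE (δ s a b)) λ a →
    eval-nodeE (λ b → leafE (δ s a b)) λ b →
    cong₂ _∙_ (eval-bitE (proj₁ (δ s a b))) (eval-bitE (proj₂ (δ s a b)))

cost-bitE : ∀ b → cost (bitE {m} b) ≤ 3
cost-bitE false = s≤s z≤n
cost-bitE true  = ≤-refl

cost-nodeE : ∀ (f : Bool → Expr m) {t} → (∀ b → cost (f b) ≤ t) → cost (nodeE f) ≤ 1 + t + t
cost-nodeE f p = s≤s (+-mono-≤ (p false) (p true))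

-- A leaf costs at most 1 + 3 + 3 = 7, and each of the three branchings turns a bound t into 1 + 2t:
-- 7, 15, 31, 63.
cost-tableE : ∀ δ → cost (tableE {m} δ) ≤ 63
cost-tableE δ =
  cost-nodeE (λ s → nodeE λ a → nodeE λ b → leafE (δ s a b)) λ s →
  cost-nodeE (λ a → nodeE λ b → leafE (δ s a b)) λ a →
  cost-nodeE (λ b → leafE (δ s a b)) λ b →
  s≤s (+-mono-≤ (cost-bitE (proj₁ (δ s a b))) (cost-bitE (proj₂ (δ s a b))))

-- Inputs in a and b, a list of the required length in r, the state in s; the
-- output is pushed on o, hence reversed, and finally returned in a.
pattern ⟨_,_,_,_,_,_,_⟩ r b s d x o a =
  r ∷ᵛ b ∷ᵛ s ∷ᵛ d ∷ᵛ x ∷ᵛ o ∷ᵛ a ∷ᵛ []ᵛ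

-- WHILE has no conditional: the two outcomes are computed beforehand and stored
-- as a pair l ∙ r in d, and x selects one of them.
select : Cmd 7
select = while var 4F ⟨ 4F ≔ nil ⨾ 3F ≔ cons (tl (var 3F)) nil ⟩ ⨾ 3F ≔ hd (var 3F)

abstract
  -- The loop clears its own condition, so it runs at most once; it moves the right component to
  -- where the final `hd` looks. The time 16 is that of the case in which it runs.
  select-runs : ∀ {v β r b s o a} (f : Bool → Tree) → truth v ≡ β →
                select ⊢ ⟨ r , b , s , node f , v , o , a ⟩ ⇒ ⟨ r , b , s , f β , nil , o , a ⟩ ⟪ 16 ⟫
  select-runs {nil}   f refl = weaken (≤ᵇ⇒≤ _ _ tt) ((_ , stop refl , ≤-refl) ⨟ set)
  select-runs {_ ∙ _} f refl =
    weaken (≤ᵇ⇒≤ _ _ tt) ((_ , loop (λ ()) (proj₁ (proj₂ (set ⨟ set))) (stop refl) , ≤-refl) ⨟ set)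

transduceStep : Machine → Cmd 7
transduceStep δ =
  3F ≔ tableE δ ⨾
  4F ≔ var 2F ⨾ select ⨾
  4F ≔ hd (var 6F) ⨾ select ⨾
  4F ≔ hd (var 1F) ⨾ select ⨾
  5F ≔ cons (hd (var 3F)) (var 5F) ⨾
  2F ≔ tl (var 3F) ⨾
  6F ≔ tl (var 6F) ⨾
  1F ≔ tl (var 1F) ⨾
  0F ≔ tl (var 0F)

-- Since head nil = tail nil = nil, both inputs continue with zeros forever.
transduce : Machine → ℕ → Bool → Tree → Tree → List Bool × Bool
transduce δ zero    s a b = [] , s
transduce δ (suc n) s a b =
  let o , s′   = δ s (truth (head a)) (truth (head b))
      os , s″ = transduce δ n s′ (tail a) (tail b)
  in o ∷ os , s″

abstract
  transduceStep-runs : ∀ δ {q r b s d os a} → let y = δ s (truth (head a)) (truth (head b)) in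
    transduceStep δ ⊢ ⟨ q ∙ r , b , encodeBool s , d , nil , encodeBits os , a ⟩
      ⇒ ⟨ r , tail b , encodeBool (proj₂ y) , leaf y , nil , encodeBits (proj₁ y ∷ os) , tail a ⟩ ⟪ 154 ⟫
  transduceStep-runs δ {q} {r} {b} {s} {d} {os} {a} =
    weaken (≤ᵇ⇒≤ _ _ tt)
      (setTo (eval-tableE δ) (cost-tableE δ) ⨟
       set ⨟ select-runs (λ s → node λ a → node λ b → leaf (δ s a b)) (truth-encodeBool s) ⨟
       set ⨟ select-runs (λ a → node λ b → leaf (δ s a b)) refl ⨟
       set ⨟ select-runs (λ b → leaf (δ s (truth (head a)) b)) refl ⨟
       set ⨟ set ⨟ set ⨟ set ⨟ set)

transducer : Machine → Cmd 7
transducer δ =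
  while var 0F ⟨ transduceStep δ ⟩ ⨾
  6F ≔ nil ⨾ 1F ≔ nil ⨾ 3F ≔ nil ⨾
  lift 5 reverseOnto

length-transduce : ∀ δ n s a b → length (proj₁ (transduce δ n s a b)) ≡ n
length-transduce δ zero    s a b = refl
length-transduce δ (suc n) s a b = cong suc (length-transduce δ n _ (tail a) (tail b))

-- Per bit, 154 for the step, 2 for the loop test and 11 for reversing the output.
transducerTime : ℕ → ℕ
transducerTime n = n * 167 + 14

abstract
  transducer-runs : ∀ δ rs s a b → let y = transduce δ (length rs) s a b in
    transducer δ ⊢ ⟨ spine rs , b , encodeBool s , nil , nil , nil , a ⟩
      ⇒ ⟨ nil , nil , encodeBool (proj₂ y) , nil , nil , nil , encodeBits (proj₁ y) ⟩
      ⟪ transducerTime (length rs) ⟫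
  transducer-runs δ rs s a b
    with (b′ , d′ , s′ , os′ , a′) , run , o-eq , s-eq ← forEach
      {A = Tree × Tree × Bool × List Bool × Tree} {e = var 0F}
      (λ { rs (b , d , s , os , a) → ⟨ spine rs , b , encodeBool s , d , nil , encodeBits os , a ⟩ })
      (λ { rs′ (b′ , d′ , s′ , os′ , a′) → let y = transduce δ (length rs) s a b
                                               y′ = transduce δ (length rs′) s′ a′ b′ in
           os′ ʳ++ proj₁ y′ ≡ proj₁ y × proj₂ y′ ≡ proj₂ y })
      refl (λ ()) (λ i → _ , transduceStep-runs δ , i) rs {_ , nil , _ , [] , _} (refl , refl)
    = weaken (≤-reflexive (trans (cong (λ k → 1 + (length rs * 156 + 2) + (9 + (k * 11 + 2))) os-length)
                                 (collect (length rs))))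
      (subst₂ (λ os s → transducer δ ⊢ _ ⇒ ⟨ nil , nil , encodeBool s , nil , nil , nil , encodeBits os ⟩ ⟪ _ ⟫)
        o-eq s-eq
      (run ⨟ set ⨟ set ⨟ set ⨟ lifted (_ ∷ᵛ _ ∷ᵛ _ ∷ᵛ _ ∷ᵛ _ ∷ᵛ []ᵛ) (reverseOnto-runs os′ [])))
    where
    collect : ∀ k → 1 + (k * 156 + 2) + (9 + (k * 11 + 2)) ≡ k * 167 + 14
    collect = solve-∀

    -- The loop rule only provides some `os′`. Its length, on which the time of the reversal
    -- depends, is recovered from the invariant.
    os-length : length os′ ≡ length rs
    os-length = trans (trans (sym (+-identityʳ _)) (sym (length-ʳ++ os′)))
                      (trans (cong length o-eq) (length-transduce δ (length rs) s a b))

-- Sets and binary numbers processed by the machines.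

members : ∀ n → Tree → Subset n
members zero    t = []ᵛ
members (suc n) t = truth (head t) ∷ᵛ members n (tail t)

bit : Bool → ℕ
bit false = 0
bit true  = 1

value : Tree → ℕ
value nil     = 0
value (a ∙ t) = bit (truth a) + 2 * value t

value-head-tail : ∀ t → value t ≡ bit (truth (head t)) + 2 * value (tail t)
value-head-tail nil     = refl
value-head-tail (a ∙ t) = refl

value-nils : ∀ n t → value (nils n t) ≡ 2 ^ n * value t
value-nils zero    t = sym (+-identityʳ _)
value-nils (suc n) t = trans (cong (2 *_) (value-nils n t)) (sym (*-assoc 2 (2 ^ n) (value t)))

full : Machine
full s a b = true , s

members-full : ∀ n s a b → members n (encodeBits (proj₁ (transduce full n s a b))) ≡ ⊤
members-full zero    s a b = refl
members-full (suc n) s a b = cong (true ∷ᵛ_) (members-full n s (tail a) (tail b))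

meet : Machine
meet s a b = a ∧ b , s

-- No lengths have to be compared: `members` and `transduce` both read a list that is too short as
-- continued by zeros.
members-meet : ∀ n s a b → members n (encodeBits (proj₁ (transduce meet n s a b))) ≡ members n a ∩ members n b
members-meet zero    s a b = refl
members-meet (suc n) s a b =
  cong₂ _∷ᵛ_ (truth-encodeBool _) (members-meet n s (tail a) (tail b))

differ : Machine
differ s a b = false , s ∨ (a xor b)

differ-true : ∀ n a b → proj₂ (transduce differ n true a b) ≡ true
differ-true zero    a b = refl
differ-true (suc n) a b = differ-true n (tail a) (tail b)

differ-sound : ∀ n a b → proj₂ (transduce differ n false a b) ≡ false → members n a ≡ members n b
differ-sound zero    a b p = refl
differ-sound (suc n) a b p with truth (head a) | truth (head b)
... | false | false = cong (false ∷ᵛ_) (differ-sound n (tail a) (tail b) p)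
... | true  | true  = cong (true ∷ᵛ_) (differ-sound n (tail a) (tail b) p)
... | false | true  with () ← trans (sym p) (differ-true n (tail a) (tail b))
... | true  | false with () ← trans (sym p) (differ-true n (tail a) (tail b))

differ-complete : ∀ n a b → proj₂ (transduce differ n false a b) ≡ true → members n a ≢ members n b
differ-complete (suc n) a b p q with truth (head a) | truth (head b)
... | false | false = differ-complete n (tail a) (tail b) p (∷-injectiveʳ q)
... | true  | true  = differ-complete n (tail a) (tail b) p (∷-injectiveʳ q)
... | false | true  with () ← ∷-injectiveˡ q
... | true  | false with () ← ∷-injectiveˡ q

inhabited : ∀ {n} → Subset n → Bool
inhabited = foldr′ _∨_ false

-- Made for the final sum: a scan keeps the entries on which the machine ends in `true`, here those
-- with empty key, and adds up the numbers of all others.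
allOutside : Machine
allOutside s a b = false , s ∧ not a

allOutside-false : ∀ n a b → proj₂ (transduce allOutside n false a b) ≡ false
allOutside-false zero    a b = refl
allOutside-false (suc n) a b = allOutside-false n (tail a) (tail b)

allOutside-correct : ∀ n a b → proj₂ (transduce allOutside n true a b) ≡ not (inhabited (members n a))
allOutside-correct zero    a b = refl
allOutside-correct (suc n) a b with truth (head a)
... | false = allOutside-correct n (tail a) (tail b)
... | true  = allOutside-false n (tail a) (tail b)

-- A full adder whose state is the carry.
add : Machine
add c a b = c xor (a xor b) , (c ∧ (a ∨ b)) ∨ (a ∧ b)

add-digit : ∀ c a b → bit c + bit a + bit b ≡ bit (proj₁ (add c a b)) + 2 * bit (proj₂ (add c a b))
add-digit false false false = refl
add-digit false false true  = refl
add-digit false true  false = refl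
add-digit false true  true  = refl
add-digit true  false false = refl
add-digit true  false true  = refl
add-digit true  true  false = refl
add-digit true  true  true  = refl

-- The output stops after `n` digits and the last carry is lost, hence the bound on the sum.
value-add : ∀ n c a b → bit c + value a + value b < 2 ^ n →
            value (encodeBits (proj₁ (transduce add n c a b))) ≡ bit c + value a + value b
value-add zero    c a b p = sym (n<1⇒n≡0 p)
value-add (suc n) c a b p = begin
  bit (truth (encodeBool o)) + 2 * value (encodeBits os)
    ≡⟨ cong₂ (λ d v → bit d + 2 * v) (truth-encodeBool o) (value-add n c′ (tail a) (tail b) bound) ⟩
  bit o + 2 * (bit c′ + value (tail a) + value (tail b))
    ≡⟨ total ⟨
  bit c + value a + value b ∎
  where
  open ≡-Reasoning
  a₀ = truth (head a)
  b₀ = truth (head b)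
  o  = proj₁ (add c a₀ b₀)
  c′ = proj₂ (add c a₀ b₀)
  os = proj₁ (transduce add n c′ (tail a) (tail b))

  regroup : ∀ c a u b v → c + (a + 2 * u) + (b + 2 * v) ≡ c + a + b + 2 * (u + v)
  regroup = solve-∀

  regroup′ : ∀ o c u v → o + 2 * c + 2 * (u + v) ≡ o + 2 * (c + u + v)
  regroup′ = solve-∀

  total : bit c + value a + value b ≡ bit o + 2 * (bit c′ + value (tail a) + value (tail b))
  total = begin
    bit c + value a + value b
      ≡⟨ cong₂ (λ u v → bit c + u + v) (value-head-tail a) (value-head-tail b) ⟩
    bit c + (bit a₀ + 2 * value (tail a)) + (bit b₀ + 2 * value (tail b))
      ≡⟨ regroup (bit c) (bit a₀) (value (tail a)) (bit b₀) (value (tail b)) ⟩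
    bit c + bit a₀ + bit b₀ + 2 * (value (tail a) + value (tail b))
      ≡⟨ cong (_+ 2 * (value (tail a) + value (tail b))) (add-digit c a₀ b₀) ⟩
    bit o + 2 * bit c′ + 2 * (value (tail a) + value (tail b))
      ≡⟨ regroup′ (bit o) (bit c′) (value (tail a)) (value (tail b)) ⟩
    bit o + 2 * (bit c′ + value (tail a) + value (tail b)) ∎

  -- Twice the left side is the whole sum without its lowest digit, so it is below 2 * 2 ^ n.
  bound : bit c′ + value (tail a) + value (tail b) < 2 ^ n
  bound = *-cancelˡ-< 2 _ _ (≤-<-trans (≤-trans (m≤n+m _ (bit o)) (≤-reflexive (sym total))) p)

-- Scanning a table.

Table : Set
Table = List (Tree × Tree)

encodeTable : Table → Tree
encodeTable = encodeList λ (k , p) → k ∙ p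

total : Table → ℕ
total []            = 0
total ((k , p) ∷ t) = value p + total t

-- The entries still to be scanned, those kept, a key and a number, a flag, and
-- two lists that measure the lengths of keys (plus one) and of numbers.
pattern ⟪_,_,_,_,_,_,_⟫∷_ t n k p e r l σ =
  t ∷ᵛ n ∷ᵛ k ∷ᵛ p ∷ᵛ e ∷ᵛ r ∷ᵛ l ∷ᵛ σ

idle : Store 7
idle = ⟨ nil , nil , nil , nil , nil , nil , nil ⟩

-- An entry is kept if the machine ends in state true on its key and k;
-- otherwise its number is added to p.
scanStep : Machine → Bool → Cmd 14
scanStep δ s =
  7F ≔ tl (var 5F) ⨾ # 13 ≔ hd (hd (var 0F)) ⨾ 8F ≔ var 2F ⨾ 9F ≔ bitE s ⨾
  lift 7 (transducer δ) ⨾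
  4F ≔ var 9F ⨾
  7F ≔ var 6F ⨾ # 13 ≔ var 3F ⨾ 8F ≔ tl (hd (var 0F)) ⨾ 9F ≔ nil ⨾
  lift 7 (transducer add) ⨾
  # 10 ≔ cons (cons (var (# 13)) (var 1F)) (cons (var 3F) (cons (hd (var 0F)) (var 1F))) ⨾
  # 11 ≔ var 4F ⨾
  lift 7 select ⨾
  3F ≔ hd (var (# 10)) ⨾ 1F ≔ tl (var (# 10)) ⨾
  # 10 ≔ nil ⨾ 9F ≔ nil ⨾ # 13 ≔ nil ⨾ 4F ≔ nil ⨾
  0F ≔ tl (var 0F)

-- The time of `scanStep` together with 2 for the loop test.
stepTime : ℕ → ℕ → ℕ
stepTime n l = 93 + (transducerTime n + transducerTime l)

scan : Machine → Bool → Cmd 14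
scan δ s = while var 0F ⟨ scanStep δ s ⟩

module _ (δ : Machine) (s : Bool) (rs ls : List Tree) (k : Tree) where

  private
    n l : ℕ
    n = length rs
    l = length ls

  flag : Tree × Tree → Bool
  flag (k′ , _) = proj₂ (transduce δ n s k′ k)

  scanStore : Table → Table × Tree → Store 14
  scanStore T (N , p) = ⟪ encodeTable T , encodeTable N , k , p , nil , nil ∙ spine rs , spine ls ⟫∷ idle

  updated : Tree × Tree → Table × Tree → Table × Tree
  updated e (N , p) =
    if flag e then e ∷ N , p else N , encodeBits (proj₁ (transduce add l false p (proj₂ e)))

  abstract
    scanStep-runs : ∀ e T a →
      scanStep δ s ⊢ scanStore (e ∷ T) a ⇒ scanStore T (updated e a)
        ⟪ 91 + (transducerTime n + transducerTime l) ⟫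
    scanStep-runs e@(k′ , q) T (N , p) = weaken (≤-reflexive (collect (transducerTime n) (transducerTime l)))
      (set ⨟ set ⨟ set ⨟ setTo (eval-bitE s) (cost-bitE s) ⨟
       lifted (_ ∷ᵛ _ ∷ᵛ _ ∷ᵛ _ ∷ᵛ _ ∷ᵛ _ ∷ᵛ _ ∷ᵛ []ᵛ) (transducer-runs δ rs s k′ k) ⨟
       set ⨟
       set ⨟ set ⨟ set ⨟ set ⨟
       lifted (_ ∷ᵛ _ ∷ᵛ _ ∷ᵛ _ ∷ᵛ _ ∷ᵛ _ ∷ᵛ _ ∷ᵛ []ᵛ) (transducer-runs add ls false p q) ⨟
       set ⨟ set ⨟
       lifted (_ ∷ᵛ _ ∷ᵛ _ ∷ᵛ _ ∷ᵛ _ ∷ᵛ _ ∷ᵛ _ ∷ᵛ []ᵛ) (select-runs choices (truth-encodeBool (flag e))) ⨟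
       setTo (head-choices (flag e)) ≤-refl ⨟ setTo (tail-choices (flag e)) ≤-refl ⨟ set ⨟ set ⨟ set ⨟ set ⨟ set)
      where
      p+q : Tree
      p+q = encodeBits (proj₁ (transduce add l false p q))

      -- Both outcomes are prepared for `select`, so the sum is computed even when the entry is kept
      -- and the sum discarded.
      choices : Bool → Tree
      choices β = if β then p ∙ encodeTable (e ∷ N) else p+q ∙ encodeTable N

      head-choices : ∀ β → head (choices β) ≡ proj₂ (if β then e ∷ N , p else N , p+q)
      head-choices false = refl
      head-choices true  = refl

      tail-choices : ∀ β → tail (choices β) ≡ encodeTable (proj₁ (if β then e ∷ N , p else N , p+q))
      tail-choices false = refl
      tail-choices true  = refl

      collect : ∀ u v → 18 + (u + (18 + (v + 55))) ≡ 91 + (u + v)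
      collect = solve-∀

  -- The last component guards against overflow. It counts all entries still to be scanned, whether
  -- they will be added or kept, and therefore survives a step with either flag.
  ScanInvariant : Table → Tree → Table → Table × Tree → Set
  ScanInvariant T p T′ (N , p′) =
    filter (T? ∘ flag) T′ ʳ++ N ≡ filter (T? ∘ flag) T ʳ++ []
    × value p′ + total (filter (T? ∘ not ∘ flag) T′) ≡ value p + total (filter (T? ∘ not ∘ flag) T)
    × value p′ + total T′ < 2 ^ l

  scanInvariant-step : ∀ {T p e T′ a} → ScanInvariant T p (e ∷ T′) a → ScanInvariant T p T′ (updated e a)
  scanInvariant-step {e = e@(k′ , q)} {T′} {N , p′} (i , j , bound) with flag e
  ... | true  = i , j , ≤-<-trans (+-monoʳ-≤ (value p′) (m≤n+m _ (value q))) bound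
  ... | false =
    i ,
    trans (trans (cong (_+ total (filter (T? ∘ not ∘ flag) T′)) sum-eq) (+-assoc (value p′) (value q) _)) j ,
    subst (_< 2 ^ l) (sym (trans (cong (_+ total T′) sum-eq) (+-assoc (value p′) (value q) _))) bound
    where
    sum-eq = value-add l false p′ q
      (≤-<-trans (≤-trans (m≤m+n _ (total T′)) (≤-reflexive (+-assoc (value p′) (value q) _))) bound)

  abstract
    scan-runs : ∀ T p → value p + total T < 2 ^ l → ∃[ q ]
      (scan δ s ⊢ scanStore T ([] , p) ⇒ scanStore [] (filter (T? ∘ flag) T ʳ++ [] , q)
        ⟪ length T * stepTime n l + 2 ⟫)
      × value q ≡ value p + total (filter (T? ∘ not ∘ flag) T)
    scan-runs T p bound = conclude
      (forEach {e = var 0F} scanStore (ScanInvariant T p)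
        refl (λ ())
        (λ {e} {T′} {a} i → updated e a , scanStep-runs e T′ a , scanInvariant-step {T} {p} {e} {T′} {a} i)
        T {[] , p} (refl , refl , bound))
      where
      conclude : ∀ {t} → ∃[ a ] (scan δ s ⊢ scanStore T ([] , p) ⇒ scanStore [] a ⟪ t ⟫) × ScanInvariant T p [] a →
                 ∃[ q ] (scan δ s ⊢ scanStore T ([] , p) ⇒ scanStore [] (filter (T? ∘ flag) T ʳ++ [] , q) ⟪ t ⟫)
                      × value q ≡ value p + total (filter (T? ∘ not ∘ flag) T)
      conclude ((_ , q) , run , refl , v-eq , _) = q , run , trans (sym (+-identityʳ _)) v-eq

-- Insertion with merging of equal keys.

AllPairs-ʳ++ : ∀ {A : Set} {R : A → A → Set} → (∀ {x y} → R x y → R y x) → ∀ {xs ys} →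
               AllPairs R xs → AllPairs R ys → All (λ x → All (R x) ys) xs → AllPairs R (xs ʳ++ ys)
AllPairs-ʳ++ R-sym []           ys! []           = ys!
AllPairs-ʳ++ R-sym (x∉xs ∷ xs!) ys! (x∉ys ∷ ps) =
  AllPairs-ʳ++ R-sym xs! (x∉ys ∷ ys!) (All.zipWith (λ (p , q) → R-sym p ∷ q) (x∉xs , ps))

-- Scanning with `differ` removes any entry with the new key and adds its number to the new one, so
-- distinct keys stay distinct.
insert : Cmd 14
insert =
  0F ≔ var 1F ⨾ 1F ≔ nil ⨾ scan differ false ⨾
  1F ≔ cons (cons (var 2F) (var 3F)) (var 1F)

module _ (n : ℕ) where

  key : Tree × Tree → Subset n
  key (k , _) = members n k

  -- The table as a linear functional of φ. It depends neither on the order of the entries nor on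
  -- whether entries with equal keys have been merged.
  weight : (Subset n → ℕ) → Table → ℕ
  weight φ []      = 0
  weight φ (e ∷ T) = φ (key e) * value (proj₂ e) + weight φ T

  total≡weight : ∀ T → total T ≡ weight (λ _ → 1) T
  total≡weight []            = refl
  total≡weight ((k , p) ∷ T) = cong₂ _+_ (sym (+-identityʳ (value p))) (total≡weight T)

  weight-ʳ++ : ∀ φ T U → weight φ (T ʳ++ U) ≡ weight φ T + weight φ U
  weight-ʳ++ φ []      U = refl
  weight-ʳ++ φ (e ∷ T) U = trans (weight-ʳ++ φ T (e ∷ U))
    (exchange (weight φ T) (φ (key e) * value (proj₂ e)) (weight φ U))
    where
    exchange : ∀ a b c → a + (b + c) ≡ b + a + c
    exchange = solve-∀

  -- The removed entries all have key `k`, so `φ k` factors out of their sum.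
  weight-merge : ∀ φ k (f : Tree × Tree → Bool) → (∀ e → f e ≡ false → key e ≡ k) → ∀ T →
    weight φ T ≡ weight φ (filter (T? ∘ f) T) + φ k * total (filter (T? ∘ not ∘ f) T)
  weight-merge φ k f p []      = sym (*-zeroʳ (φ k))
  weight-merge φ k f p (e ∷ T) with f e in eq
  ... | true  = trans (cong (φ (key e) * value (proj₂ e) +_) (weight-merge φ k f p T))
                      (sym (+-assoc (φ (key e) * value (proj₂ e)) _ _))
  ... | false rewrite p e eq = trans (cong (φ k * value (proj₂ e) +_) (weight-merge φ k f p T))
      (distribute (φ k) (value (proj₂ e)) (weight φ (filter (T? ∘ f) T)) (total (filter (T? ∘ not ∘ f) T)))
    where
    distribute : ∀ a q w t → a * q + (w + a * t) ≡ w + a * (q + t)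
    distribute = solve-∀

  Distinct : Table → Set
  Distinct = AllPairs (λ e e′ → key e ≢ key e′)

module _ (rs ls : List Tree) where

  private
    n l : ℕ
    n = length rs
    l = length ls

  insertStore : Tree → Tree → Table → Store 14
  insertStore k p N = ⟪ nil , encodeTable N , k , p , nil , nil ∙ spine rs , spine ls ⟫∷ idle

  record Inserted (k p : Tree) (N N′ : Table) : Set₁ where
    field
      weight-eq : ∀ φ → weight n φ N′ ≡ φ (members n k) * value p + weight n φ N
      distinct  : Distinct n N → Distinct n N′
      all-keys  : ∀ {Q : Subset n → Set} → Q (members n k) → All (Q ∘ key n) N → All (Q ∘ key n) N′

  module _ (k : Tree) (N : Table) where

    private
      same others : Table
      same   = filter (T? ∘ not ∘ flag differ false rs ls k) N
      others = filter (T? ∘ flag differ false rs ls k) N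

      T⇒≡ : ∀ {b} → T b → b ≡ true
      T⇒≡ {true} _ = refl

      regroup : ∀ a p s w → a * (p + s) + w ≡ a * p + (w + a * s)
      regroup = solve-∀

      collect : ∀ u → 7 + (u + 2 + 6) ≡ 15 + u
      collect = solve-∀

    merged : ∀ {p q} → value q ≡ value p + total same → Inserted k p N ((k , q) ∷ (others ʳ++ []))
    merged {p} {q} q-eq = record
      { weight-eq = λ φ → begin
          φ (members n k) * value q + weight n φ (others ʳ++ [])
            ≡⟨ cong₂ (λ v w → φ (members n k) * v + w) q-eq (trans (weight-ʳ++ n φ others []) (+-identityʳ _)) ⟩
          φ (members n k) * (value p + total same) + weight n φ others
            ≡⟨ regroup (φ (members n k)) (value p) (total same) (weight n φ others) ⟩
          φ (members n k) * value p + (weight n φ others + φ (members n k) * total same)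
            ≡⟨ cong (φ (members n k) * value p +_)
                 (weight-merge n φ (members n k) _ (λ e → differ-sound n (proj₁ e) k) N) ⟨
          φ (members n k) * value p + weight n φ N ∎
      ; distinct = λ N! →
          All-resp-↭ (↭-sym (↭-reverse others))
            (All.map (λ {e} p q → differ-complete n (proj₁ e) k (T⇒≡ p) (sym q)) (All.all-filter _ N))
          ∷ AllPairs-ʳ++ (λ p → p ∘ sym) (AllPairs.filter⁺ _ N!) [] (All.universal (λ _ → []) others)
      ; all-keys = λ qk qN → qk ∷ All-resp-↭ (↭-sym (↭-reverse others)) (All.filter⁺ _ qN)
      }
      where open ≡-Reasoning

    abstract
      insert-runs : ∀ p → value p + total N < 2 ^ l → ∃[ q ] ∃[ N′ ]
        (insert ⊢ insertStore k p N ⇒ insertStore k q N′ ⟪ 15 + length N * stepTime n l ⟫) × Inserted k p N N′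
      insert-runs p bound =
        let q , run , q-eq = scan-runs differ false rs ls k N p bound in
        q , _ , weaken (≤-reflexive (collect (length N * stepTime n l))) (set ⨟ set ⨟ run ⨟ set) , merged q-eq

-- One round for each vertex.

-- Register 0 holds the rows to be processed and register 1 the table; the entry
-- (k , p) contributes (k , p) and (k ∩ row , 2 ^ (n + 1) * p) to the new table.
extend : Cmd 16
extend =
  4F ≔ hd (hd (var 1F)) ⨾ 5F ≔ tl (hd (var 1F)) ⨾
  lift 2 insert ⨾
  9F ≔ tl (var 7F) ⨾ # 15 ≔ hd (hd (var 1F)) ⨾ # 10 ≔ hd (var 0F) ⨾
  lift 9 (transducer meet) ⨾
  4F ≔ var (# 15) ⨾ # 11 ≔ nil ⨾ # 14 ≔ var 7F ⨾ # 15 ≔ tl (hd (var 1F)) ⨾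
  lift 14 zeros ⨾
  5F ≔ var (# 15) ⨾ # 15 ≔ nil ⨾
  lift 2 insert ⨾
  4F ≔ nil ⨾ 5F ≔ nil ⨾ 1F ≔ tl (var 1F)

round allRounds : Cmd 16
round = while var 1F ⟨ extend ⟩ ⨾ 1F ≔ var 3F ⨾ 3F ≔ nil ⨾ 0F ≔ tl (var 0F)
allRounds = while var 0F ⟨ round ⟩

module _ {n : ℕ} (B : ℕ) where

  -- The dual of scanning a vertex with neighborhood `R`: the weight of the new table under φ is the
  -- weight of the old one under `spread R φ`. Here `B` takes the place of x.
  spread : Subset n → (Subset n → ℕ) → Subset n → ℕ
  spread R φ C = φ C + B * φ (C ∩ R)

  -- Sums, over all sets of the listed rows, B to the number of rows times φ of
  -- the intersection of C with these rows.
  extensions : List Tree → (Subset n → ℕ) → Subset n → ℕ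
  extensions []       φ = φ
  extensions (r ∷ rs) φ = spread (members n r) (extensions rs φ)

  extensions-positive : ∀ rs C → 1 ≤ extensions rs (λ _ → 1) C
  extensions-positive []       C = ≤-refl
  extensions-positive (r ∷ rs) C = ≤-trans (extensions-positive rs C) (m≤m+n _ _)

weight-mono : ∀ {n} {φ ψ : Subset n → ℕ} → (∀ C → φ C ≤ ψ C) → ∀ T → weight n φ T ≤ weight n ψ T
weight-mono     φ≤ψ []      = z≤n
weight-mono {n} φ≤ψ (e ∷ T) = +-mono-≤ (*-monoˡ-≤ (value (proj₂ e)) (φ≤ψ (key n e))) (weight-mono φ≤ψ T)

-- Two registers in front of the fourteen of `scan`, the last seven of which belong to `transducer`;
-- this explains the offsets 2 and 9 in the calls.
mainStore : List Tree → List Tree → Tree → Tree → Tree → Table → Tree → Tree → Tree → Store 16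
mainStore rs ls x t m N k p a =
  x ∷ᵛ t ∷ᵛ ⟪ m , encodeTable N , k , p , nil , nil ∙ spine rs , spine ls ⟫∷
    ⟨ nil , nil , nil , nil , nil , nil , a ⟩

insertTime extendTime roundTime : ℕ → ℕ → ℕ → ℕ
insertTime n l S = 15 + S * stepTime n l
extendTime n l S = 56 + (insertTime n l S + insertTime n l S + (transducerTime n + (suc n * 10 + 2)))
roundTime  n l S = S * (2 + extendTime n l S) + 12

module _ (rs ls : List Tree) (S : ℕ) (Key : Subset (length rs) → Set) where

  private
    n l w : ℕ
    n = length rs
    l = length ls
    w = suc n

  -- `Key` will be the property of being a common neighborhood and `S` the bound on the number of
  -- such sets. Kept abstract, they separate the analysis of the program from graph theory.
  record Valid (T : Table) : Set where
    constructor valid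
    field
      distinct : Distinct n T
      all-keys : All (Key ∘ key n) T

  module _ (bounded : ∀ {T} → Valid T → length T ≤ S) where

    abstract
      lifted-insert : ∀ {x t} k p N → Valid N → Key (members n k) → value p + total N < 2 ^ l → ∃[ q ] ∃[ N′ ]
        (lift 2 insert ⊢ mainStore rs ls x t nil N k p nil ⇒ mainStore rs ls x t nil N′ k q nil ⟪ insertTime n l S ⟫)
        × (∀ φ → weight n φ N′ ≡ φ (members n k) * value p + weight n φ N) × Valid N′
      lifted-insert k p N N-valid k-key bound =
        let q , N′ , run , ins = insert-runs rs ls k N p bound in
        q , N′ ,
        lifted (_ ∷ᵛ _ ∷ᵛ []ᵛ) (weaken (+-monoʳ-≤ 15 (*-monoˡ-≤ (stepTime n l) (bounded N-valid))) run) ,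
        Inserted.weight-eq ins ,
        valid (Inserted.distinct ins (Valid.distinct N-valid))
              (Inserted.all-keys ins {Key} k-key (Valid.all-keys N-valid))

    module _ (r : Tree) (closed : ∀ {C} → Key C → Key (C ∩ members n r)) (xs : List Tree) where

      roundStore : Table → Table → Store 16
      roundStore T N = mainStore rs ls (spine (r ∷ xs)) (encodeTable T) nil N nil nil nil

      R : Subset n
      R = members n r

      -- The bound concerns the total after both insertions. The factor `1 + 2 ^ w * 1` is what
      -- `spread` becomes for the constant function 1.
      extend-runs : ∀ {k p T N} → Valid N → Key (members n k) →
        total N + (1 + 2 ^ w * 1) * value p < 2 ^ l → ∃[ N′ ]
        (extend ⊢ roundStore ((k , p) ∷ T) N ⇒ roundStore T N′ ⟪ extendTime n l S ⟫)
        × (∀ φ → weight n φ N′ ≡ weight n φ N + spread (2 ^ w) R φ (members n k) * value p) × Valid N′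
      extend-runs {k} {p} {T} {N} N-valid k-key bound =
        let q₁ , N₁ , run₁ , w₁ , N₁-valid = lifted-insert k p N N-valid k-key bound₁
            q₂ , N₂ , run₂ , w₂ , N₂-valid = lifted-insert k′ p′ N₁ N₁-valid k′-key (bound₂ N₁ w₁)
        in N₂ ,
           weaken (≤-reflexive (collect (insertTime n l S) (transducerTime n) (w * 10 + 2)))
             (set ⨟ set ⨟ run₁ ⨟ set ⨟ set ⨟ set ⨟
              lifted (_ ∷ᵛ _ ∷ᵛ _ ∷ᵛ _ ∷ᵛ _ ∷ᵛ _ ∷ᵛ _ ∷ᵛ _ ∷ᵛ _ ∷ᵛ []ᵛ) (transducer-runs meet rs false k r) ⨟
              set ⨟ set ⨟ set ⨟ set ⨟
              lifted (_ ∷ᵛ _ ∷ᵛ _ ∷ᵛ _ ∷ᵛ _ ∷ᵛ _ ∷ᵛ _ ∷ᵛ _ ∷ᵛ _ ∷ᵛ _ ∷ᵛ _ ∷ᵛ _ ∷ᵛ _ ∷ᵛ _ ∷ᵛ []ᵛ)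
                (zeros-runs (nil ∷ rs) p) ⨟
              set ⨟ set ⨟ run₂ ⨟ set ⨟ set ⨟ set) ,
           weights N₁ N₂ w₁ w₂ , N₂-valid
        where
        k′ p′ : Tree
        k′ = encodeBits (proj₁ (transduce meet n false k r))
        p′ = nils w p

        k′-members : members n k′ ≡ members n k ∩ R
        k′-members = members-meet n false k r

        k′-key : Key (members n k′)
        k′-key = subst Key (sym k′-members) (closed k-key)

        bound₁ : value p + total N < 2 ^ l
        bound₁ = ≤-<-trans
          (≤-trans (≤-reflexive (+-comm (value p) (total N))) (+-monoʳ-≤ (total N) (m≤m+n (value p) _)))
          bound

        weights : ∀ N₁ N₂ →
          (∀ φ → weight n φ N₁ ≡ φ (members n k) * value p + weight n φ N) →
          (∀ φ → weight n φ N₂ ≡ φ (members n k′) * value p′ + weight n φ N₁) →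
          ∀ φ → weight n φ N₂ ≡ weight n φ N + spread (2 ^ w) R φ (members n k) * value p
        weights N₁ N₂ w₁ w₂ φ = begin
          weight n φ N₂
            ≡⟨ w₂ φ ⟩
          φ (members n k′) * value p′ + weight n φ N₁
            ≡⟨ cong₂ (λ C v → φ C * v + weight n φ N₁) k′-members (value-nils w p) ⟩
          φ (members n k ∩ R) * (2 ^ w * value p) + weight n φ N₁
            ≡⟨ cong (φ (members n k ∩ R) * (2 ^ w * value p) +_) (w₁ φ) ⟩
          φ (members n k ∩ R) * (2 ^ w * value p) + (φ (members n k) * value p + weight n φ N)
            ≡⟨ regroup (φ (members n k ∩ R)) (2 ^ w) (value p) (φ (members n k)) (weight n φ N) ⟩
          weight n φ N + spread (2 ^ w) R φ (members n k) * value p ∎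
          where
          open ≡-Reasoning
          regroup : ∀ x b v y z → x * (b * v) + (y * v + z) ≡ z + (y + b * x) * v
          regroup = solve-∀

        bound₂ : ∀ N₁ → (∀ φ → weight n φ N₁ ≡ φ (members n k) * value p + weight n φ N) →
                 value p′ + total N₁ < 2 ^ l
        bound₂ N₁ w₁ = ≤-<-trans (≤-reflexive total-eq) bound
          where
          open ≡-Reasoning
          regroup : ∀ b v z → b * v + (1 * v + z) ≡ z + (1 + b * 1) * v
          regroup = solve-∀

          total-eq : value p′ + total N₁ ≡ total N + (1 + 2 ^ w * 1) * value p
          total-eq = begin
            value p′ + total N₁
              ≡⟨ cong₂ _+_ (value-nils w p) (trans (total≡weight n N₁) (w₁ _)) ⟩
            2 ^ w * value p + (1 * value p + weight n (λ _ → 1) N)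
              ≡⟨ cong (λ t → 2 ^ w * value p + (1 * value p + t)) (total≡weight n N) ⟨
            2 ^ w * value p + (1 * value p + total N)
              ≡⟨ regroup (2 ^ w) (value p) (total N) ⟩
            total N + (1 + 2 ^ w * 1) * value p ∎

        collect : ∀ i u z → 11 + (i + (14 + (u + (15 + (z + (7 + (i + 9))))))) ≡ 56 + (i + i + (u + z))
        collect = solve-∀

      -- A conserved quantity: an entry leaves `T` with its spread weight and brings exactly this
      -- weight to `N`. For φ = 1 it bounds every partial total; validity of `N` bounds the time of
      -- the insertions during the round.
      RoundInvariant : Table → Table → Table → Set
      RoundInvariant T₀ T N =
        (∀ φ → weight n φ N + weight n (spread (2 ^ w) R φ) T ≡ weight n (spread (2 ^ w) R φ) T₀)
        × Valid N × All (Key ∘ key n) T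

      module _ (T₀ : Table) (T₀-bound : weight n (spread (2 ^ w) R (λ _ → 1)) T₀ < 2 ^ l) where

        extend-invariant : ∀ {e T N} → RoundInvariant T₀ (e ∷ T) N → ∃[ N′ ]
          (extend ⊢ roundStore (e ∷ T) N ⇒ roundStore T N′ ⟪ extendTime n l S ⟫) × RoundInvariant T₀ T N′
        extend-invariant {e@(k , p)} {T} {N} (weights , N-valid , k-key ∷ T-keys) =
          let N′ , run , weights′ , N′-valid = extend-runs {T = T} N-valid k-key bound in
          N′ , run ,
          (λ φ → trans (cong (_+ weight n (spread (2 ^ w) R φ) T) (weights′ φ))
                       (trans (+-assoc (weight n φ N) _ _) (weights φ))) ,
          N′-valid , T-keys
          where
          bound : total N + (1 + 2 ^ w * 1) * value p < 2 ^ l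
          bound = ≤-<-trans
            (≤-trans (+-mono-≤ (≤-reflexive (total≡weight n N)) (m≤m+n _ (weight n _ T)))
                     (≤-reflexive (weights (λ _ → 1))))
            T₀-bound

        abstract
          round-runs : Valid T₀ → ∃[ T₁ ]
            (round ⊢ roundStore T₀ []
               ⇒ mainStore rs ls (spine xs) (encodeTable T₁) nil [] nil nil nil ⟪ roundTime n l S ⟫)
            × (∀ φ → weight n φ T₁ ≡ weight n (spread (2 ^ w) R φ) T₀) × Valid T₁
          round-runs T₀-valid =
            let T₁ , run , weights , T₁-valid , _ =
                  forEach {e = var 1F} roundStore (RoundInvariant T₀) refl (λ ()) extend-invariant
                    T₀ {[]} ((λ φ → refl) , valid [] [] , Valid.all-keys T₀-valid)
            in T₁ ,
               weaken time (run ⨟ set ⨟ set ⨟ set) ,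
               (λ φ → trans (sym (+-identityʳ _)) (weights φ)) ,
               T₁-valid
            where
            collect : ∀ u → 1 + (u + 2) + 9 ≡ u + 12
            collect = solve-∀

            time : 1 + (length T₀ * (2 + extendTime n l S) + 2) + 9 ≤ roundTime n l S
            time = ≤-trans (≤-reflexive (collect (length T₀ * (2 + extendTime n l S))))
                     (+-monoˡ-≤ 12 (*-monoˡ-≤ (2 + extendTime n l S) (bounded T₀-valid)))

    ClosedUnder : Tree → Set
    ClosedUnder r = ∀ {C} → Key C → Key (C ∩ members n r)

    module _ (T₀ : Table) (T₀-valid : Valid T₀) (xs : List Tree) (xs-closed : All ClosedUnder xs)
             (T₀-bound : weight n (extensions (2 ^ w) xs (λ _ → 1)) T₀ < 2 ^ l) where

      loopStore : List Tree → Table → Store 16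
      loopStore xs T = mainStore rs ls (spine xs) (encodeTable T) nil [] nil nil nil

      RoundsInvariant : List Tree → Table → Set
      RoundsInvariant ys T =
        (∀ φ → weight n (extensions (2 ^ w) ys φ) T ≡ weight n (extensions (2 ^ w) xs φ) T₀)
        × Valid T × All ClosedUnder ys

      round-invariant : ∀ {y ys T} → RoundsInvariant (y ∷ ys) T → ∃[ T′ ]
        (round ⊢ loopStore (y ∷ ys) T ⇒ loopStore ys T′ ⟪ roundTime n l S ⟫) × RoundsInvariant ys T′
      round-invariant {y} {ys} {T} (weights , T-valid , y-closed ∷ ys-closed) =
        let T′ , run , weights′ , T′-valid = round-runs y y-closed ys T bound T-valid in
        T′ , run , (λ φ → trans (weights′ (extensions (2 ^ w) ys φ)) (weights φ)) , T′-valid , ys-closed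
        where
        -- The total after this round is at most the total after all rounds, because `extensions` of
        -- the constant 1 is at least 1 everywhere; the latter total is bounded by assumption.
        bound : weight n (spread (2 ^ w) (members n y) (λ _ → 1)) T < 2 ^ l
        bound = ≤-<-trans
          (≤-trans
            (weight-mono
              (λ C → +-mono-≤ (extensions-positive (2 ^ w) ys C)
                              (*-monoʳ-≤ (2 ^ w) (extensions-positive (2 ^ w) ys (C ∩ members n y)))) T)
            (≤-reflexive (weights (λ _ → 1))))
          T₀-bound

      abstract
        allRounds-runs : ∃[ T ]
          (allRounds ⊢ loopStore xs T₀ ⇒ loopStore [] T ⟪ length xs * (2 + roundTime n l S) + 2 ⟫)
          × (∀ φ → weight n φ T ≡ weight n (extensions (2 ^ w) xs φ) T₀) × Valid T
        allRounds-runs =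
          let T , run , weights , T-valid , _ =
                forEach {e = var 0F} loopStore RoundsInvariant refl (λ ()) round-invariant
                  xs {T₀} ((λ φ → refl) , T₀-valid , xs-closed)
          in T , run , weights , T-valid

-- Setup, final sum and extraction of the digits.

nils-+ : ∀ m n t → nils (m + n) t ≡ nils m (nils n t)
nils-+ zero    n t = refl
nils-+ (suc m) n t = cong (nil ∙_) (nils-+ m n t)

nils-spine : ∀ n → nils n nil ≡ spine (List.replicate n nil)
nils-spine zero    = refl
nils-spine (suc n) = cong (nil ∙_) (nils-spine n)

-- The ruler for numbers has length (n+1)^2: one block of n+1 bits for each of the n+1 coefficients.
buildRuler setup : Cmd 16
buildRuler = while var 2F ⟨ # 14 ≔ var 7F ⨾ lift 14 zeros ⨾ 2F ≔ tl (var 2F) ⟩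
setup =
  7F ≔ cons nil (var 0F) ⨾ 2F ≔ var 7F ⨾
  buildRuler ⨾
  8F ≔ var (# 15) ⨾ # 15 ≔ nil ⨾ 9F ≔ var 0F ⨾
  lift 9 (transducer full) ⨾
  # 11 ≔ nil ⨾
  -- Before the first scan only A = ∅ counts: its common neighborhood is the whole vertex set, and
  -- its number is 1.
  1F ≔ cons (cons (var (# 15)) (cons (cons nil nil) nil)) nil ⨾ # 15 ≔ nil

-- The last addition, of 0, brings the sum to its full length, so that the blocks
-- taken from its upper end by chop are the digits in base 2 ^ (n + 1).
gather : Cmd 16
gather =
  2F ≔ var 1F ⨾ 1F ≔ nil ⨾
  lift 2 (scan allOutside true) ⨾
  3F ≔ nil ⨾ 9F ≔ var 8F ⨾ # 15 ≔ var 5F ⨾ 5F ≔ nil ⨾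
  lift 9 (transducer add) ⨾
  # 11 ≔ nil ⨾ # 14 ≔ var (# 15) ⨾ # 15 ≔ nil ⨾
  lift 14 reverseOnto

-- Bits arrive with the most significant one first. Pushing them on a list leaves the block with its
-- least significant bit first, and pushing the blocks likewise leaves the constant term first, as
-- the output requires.
takeBlock : Cmd 16
takeBlock = while var (# 14) ⟨
  4F ≔ cons (hd (var (# 15))) (var 4F) ⨾ # 15 ≔ tl (var (# 15)) ⨾ # 14 ≔ tl (var (# 14)) ⟩

chopStep chop : Cmd 16
chopStep = # 14 ≔ var 7F ⨾ 4F ≔ nil ⨾ takeBlock ⨾ 0F ≔ cons (var 4F) (var 0F) ⨾ 2F ≔ tl (var 2F)
chop = 2F ≔ var 7F ⨾ while var 2F ⟨ chopStep ⟩

-- One step of Horner's rule: `foldl pushBit 0` reads a number from its most significant bit, the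
-- order in which `gather` leaves the sum.
pushBit : ℕ → Bool → ℕ
pushBit v b = bit b + 2 * v

pushBits-reverse : ∀ bs → foldl pushBit 0 (reverse bs) ≡ value (encodeBits bs)
pushBits-reverse bs = trans (reverse-foldl pushBit 0 bs) (go bs)
  where
  go : ∀ bs → foldr (flip pushBit) 0 bs ≡ value (encodeBits bs)
  go []       = refl
  go (b ∷ bs) = cong₂ (λ c v → bit c + 2 * v) (sym (truth-encodeBool b)) (go bs)

value-encodeBits : ∀ bs → value (encodeBits bs) < 2 ^ length bs
value-encodeBits []       = s≤s z≤n
value-encodeBits (b ∷ bs) = begin-strict
  bit (truth (encodeBool b)) + 2 * value (encodeBits bs)
    <⟨ +-monoˡ-< (2 * value (encodeBits bs)) (bit<2 (truth (encodeBool b))) ⟩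
  2 + 2 * value (encodeBits bs)
    ≡⟨ *-suc 2 (value (encodeBits bs)) ⟨
  2 * suc (value (encodeBits bs))
    ≤⟨ *-monoʳ-≤ 2 (value-encodeBits bs) ⟩
  2 * 2 ^ length bs ∎
  where
  open ≤-Reasoning
  bit<2 : ∀ b → bit b < 2
  bit<2 false = s≤s z≤n
  bit<2 true  = s≤s (s≤s z≤n)

horner : ℕ → List (List Bool) → ℕ
horner B []       = 0
horner B (k ∷ ks) = value (encodeBits k) + B * horner B ks

total-inhabited : ∀ n T →
  total (filter (T? ∘ not ∘ λ (k , _) → proj₂ (transduce allOutside n true k nil)) T)
  ≡ weight n (bit ∘ inhabited) T
total-inhabited n [] = refl
total-inhabited n ((k , p) ∷ T)
  rewrite allOutside-correct n k nil with inhabited (members n k)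
... | true  = cong₂ _+_ (sym (+-identityʳ (value p))) (total-inhabited n T)
... | false = total-inhabited n T

rulerTime setupTime blockTime chopTime : ℕ → ℕ
rulerTime n = suc n * 10 + 2 + 7
setupTime n = suc n * (2 + rulerTime n) + transducerTime n + 37
blockTime n = suc n * 15 + 2
chopTime  n = 3 + (suc n * (2 + (15 + blockTime n)) + 2)

gatherTime : ℕ → ℕ → ℕ → ℕ
gatherTime n l S = 29 + (S * stepTime n l + 2 + transducerTime l + (l * 11 + 2))

module _ (rs : List Tree) where

  private
    n w : ℕ
    n = length rs
    w = suc n

    ls : List Tree
    ls = List.replicate (w * w) nil

    l = length ls

  rulerStore : List Tree → Tree → Store 16
  rulerStore ys t =
    spine rs ∷ᵛ nil ∷ᵛ ⟪ spine ys , nil , nil , nil , nil , nil ∙ spine rs , nil ⟫∷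
      ⟨ nil , nil , nil , nil , nil , nil , t ⟩

  ones : Tree
  ones = encodeBits (proj₁ (transduce full n false nil nil))

  abstract
    ruler-runs : buildRuler ⊢ rulerStore (nil ∷ rs) nil ⇒ rulerStore [] (spine ls) ⟪ w * (2 + rulerTime n) + 2 ⟫
    ruler-runs =
      let t , run , t-eq = forEach {e = var 2F} rulerStore
            (λ ys t → nils (length ys * w) t ≡ nils (w * w) nil)
            refl (λ ())
            (λ {y} {ys} {t} i → nils w t ,
              (weaken (≤-reflexive (collect (w * 10 + 2)))
                (set ⨟
                 lifted (_ ∷ᵛ _ ∷ᵛ _ ∷ᵛ _ ∷ᵛ _ ∷ᵛ _ ∷ᵛ _ ∷ᵛ _ ∷ᵛ _ ∷ᵛ _ ∷ᵛ _ ∷ᵛ _ ∷ᵛ _ ∷ᵛ _ ∷ᵛ []ᵛ)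
                   (zeros-runs (nil ∷ rs) t) ⨟
                 set)) ,
              trans (sym (nils-+ (length ys * w) w t)) (trans (cong (λ c → nils c t) (+-comm (length ys * w) w)) i))
            (nil ∷ rs) {nil} refl
      in subst (λ t → buildRuler ⊢ rulerStore (nil ∷ rs) nil ⇒ rulerStore [] t ⟪ w * (2 + rulerTime n) + 2 ⟫)
               (trans t-eq (nils-spine (w * w))) run
      where
      collect : ∀ u → 1 + 2 + (1 + u + 3) ≡ u + 7
      collect = solve-∀

    setup-runs : setup ⊢ spine rs ∷ᵛ Vec.replicate 15 nil ⇒
      mainStore rs ls (spine rs) (encodeTable ((ones , (nil ∙ nil) ∙ nil) ∷ [])) nil [] nil nil nil ⟪ setupTime n ⟫
    setup-runs = weaken (≤-reflexive (collect (w * (2 + rulerTime n)) (transducerTime n)))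
      (set ⨟ set ⨟ ruler-runs ⨟ set ⨟ set ⨟ set ⨟
       lifted (_ ∷ᵛ _ ∷ᵛ _ ∷ᵛ _ ∷ᵛ _ ∷ᵛ _ ∷ᵛ _ ∷ᵛ _ ∷ᵛ _ ∷ᵛ []ᵛ) (transducer-runs full rs false nil nil) ⨟
       set ⨟ set ⨟ set)
      where
      collect : ∀ u v → 9 + (u + 2 + (10 + (v + 16))) ≡ u + v + 37
      collect = solve-∀

  Gathered : ℕ → Table → Set
  Gathered S T = ∃[ os ]
    (gather ⊢ mainStore rs ls nil (encodeTable T) nil [] nil nil nil
       ⇒ mainStore rs ls nil nil nil [] nil nil (encodeBits (reverse os)) ⟪ gatherTime n l S ⟫)
    × length os ≡ l × value (encodeBits os) ≡ weight n (bit ∘ inhabited) T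

  module _ {S : ℕ} {T : Table} (bounded : length T ≤ S) (bound : total T < 2 ^ l) where

    gathered : ∃[ q ] (scan allOutside true ⊢ scanStore allOutside true rs ls nil T ([] , nil)
        ⇒ scanStore allOutside true rs ls nil [] (filter (T? ∘ flag allOutside true rs ls nil) T ʳ++ [] , q)
        ⟪ length T * stepTime n l + 2 ⟫)
      × value q ≡ total (filter (T? ∘ not ∘ flag allOutside true rs ls nil) T) →
      Gathered S T
    gathered (q , run , q-eq) =
      os ,
      weaken time
        (set ⨟ set ⨟ lifted (_ ∷ᵛ _ ∷ᵛ []ᵛ) run ⨟
         set ⨟ set ⨟ set ⨟ set ⨟
         lifted (_ ∷ᵛ _ ∷ᵛ _ ∷ᵛ _ ∷ᵛ _ ∷ᵛ _ ∷ᵛ _ ∷ᵛ _ ∷ᵛ _ ∷ᵛ []ᵛ) (transducer-runs add ls false q nil) ⨟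
         set ⨟ set ⨟ set ⨟
         lifted (_ ∷ᵛ _ ∷ᵛ _ ∷ᵛ _ ∷ᵛ _ ∷ᵛ _ ∷ᵛ _ ∷ᵛ _ ∷ᵛ _ ∷ᵛ _ ∷ᵛ _ ∷ᵛ _ ∷ᵛ _ ∷ᵛ _ ∷ᵛ []ᵛ)
           (reverseOnto-runs os [])) ,
      os-length ,
      trans (value-add l false q nil (subst (_< 2 ^ l) (sym (+-identityʳ (value q))) q-bound))
            (trans (+-identityʳ (value q)) q-weight)
      where
      os = proj₁ (transduce add l false q nil)

      os-length : length os ≡ l
      os-length = length-transduce add l false q nil

      q-weight : value q ≡ weight n (bit ∘ inhabited) T
      q-weight = trans q-eq (total-inhabited n T)

      bit≤1 : ∀ b → bit b ≤ 1
      bit≤1 false = z≤n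
      bit≤1 true  = ≤-refl

      q-bound : value q < 2 ^ l
      q-bound = ≤-<-trans
        (≤-trans (≤-reflexive q-weight)
          (≤-trans (weight-mono (λ C → bit≤1 (inhabited C)) T) (≤-reflexive (sym (total≡weight n T)))))
        bound

      collect : ∀ u v z → 7 + (u + (13 + (v + (9 + z)))) ≡ 29 + (u + v + z)
      collect = solve-∀

      time : 7 + (length T * stepTime n l + 2 + (13 + (transducerTime l + (9 + (length os * 11 + 2)))))
             ≤ gatherTime n l S
      time = ≤-trans
        (≤-reflexive (trans (collect (length T * stepTime n l + 2) (transducerTime l) (length os * 11 + 2))
                            (cong (λ k → 29 + (length T * stepTime n l + 2 + transducerTime l + (k * 11 + 2)))
                                  os-length)))
        (+-monoʳ-≤ 29 (+-monoˡ-≤ (l * 11 + 2) (+-monoˡ-≤ (transducerTime l)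
          (+-monoˡ-≤ 2 (*-monoˡ-≤ (stepTime n l) bounded)))))

    abstract
      gather-runs : Gathered S T
      gather-runs = gathered (scan-runs allOutside true rs ls nil T nil bound)

  chopStore : Tree → List Tree → List (List Bool) → List Bool × List Bool → Store 16
  chopStore m ys blocks (k , bs) =
    encodeList encodeBits blocks ∷ᵛ nil ∷ᵛ ⟪ m , nil , encodeBits k , nil , nil , nil ∙ spine rs , spine ls ⟫∷
      ⟨ nil , nil , nil , nil , nil , spine ys , encodeBits bs ⟩

  -- bs lists bits with the most significant one first; the blocks hold the more
  -- significant digits that have been read before.
  BlockInvariant : ℕ → ℕ → ℕ → List Tree → List Bool × List Bool → Set
  BlockInvariant j h V ys (k , bs) =
    length k + length ys ≡ w × length bs ≡ length ys + j
    × foldl pushBit (h * 2 ^ length k + value (encodeBits k)) bs ≡ V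

  blockInvariant-step : ∀ {j h V y ys k b bs} →
    BlockInvariant j h V (y ∷ ys) (k , b ∷ bs) → BlockInvariant j h V ys (b ∷ k , bs)
  blockInvariant-step {h = h} {V} {ys = ys} {k} {b} {bs} (k-length , bs-length , v) =
    trans (sym (+-suc (length k) (length ys))) k-length ,
    suc-injective bs-length ,
    trans (cong (λ v → foldl pushBit v bs) pushed) v
    where
    regroup : ∀ h p b v → h * (2 * p) + (b + 2 * v) ≡ b + 2 * (h * p + v)
    regroup = solve-∀

    pushed : h * 2 ^ length (b ∷ k) + value (encodeBits (b ∷ k)) ≡ pushBit (h * 2 ^ length k + value (encodeBits k)) b
    pushed = trans (cong (λ c → h * 2 ^ length (b ∷ k) + (bit c + 2 * value (encodeBits k))) (truth-encodeBool b))
                   (regroup h (2 ^ length k) (bit b) (value (encodeBits k)))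

  ChopInvariant : ℕ → List Tree → List (List Bool) × List Bool × List Bool → Set
  ChopInvariant V ys (blocks , _ , bs) =
    length blocks + length ys ≡ w × length bs ≡ length ys * w
    × All (λ k → value (encodeBits k) < 2 ^ w) blocks
    × foldl pushBit (horner (2 ^ w) blocks) bs ≡ V

  abstract
    takeBlock-runs : ∀ m blocks j h V bs → BlockInvariant j h V (nil ∷ rs) ([] , bs) → ∃[ a ]
      (takeBlock ⊢ chopStore m (nil ∷ rs) blocks ([] , bs) ⇒ chopStore m [] blocks a ⟪ blockTime n ⟫)
      × BlockInvariant j h V [] a
    takeBlock-runs m blocks j h V bs = forEach {e = var (# 14)} (λ ys → chopStore m ys blocks) (BlockInvariant j h V)
      refl (λ ())
      (λ { {xs = ys} {k , b ∷ bs} i →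
             (b ∷ k , bs) , (set ⨟ set ⨟ set) , blockInvariant-step {j} {h} {V} {nil} {ys} {k} {b} {bs} i })
      (nil ∷ rs)

  -- A later block is less significant, so it becomes the constant term and raises the earlier ones
  -- by a factor `2 ^ w`.
  chopInvariant-step : ∀ {V ys blocks k bs} → length blocks + suc (length ys) ≡ w →
    All (λ k → value (encodeBits k) < 2 ^ w) blocks →
    BlockInvariant (length ys * w) (horner (2 ^ w) blocks) V [] (k , bs) → ChopInvariant V ys (k ∷ blocks , k , bs)
  chopInvariant-step {V} {ys} {blocks} {k} {bs} blocks-length small (k-length , bs-length , v) =
    trans (sym (+-suc (length blocks) (length ys))) blocks-length ,
    bs-length ,
    subst (λ w′ → value (encodeBits k) < 2 ^ w′) length-k (value-encodeBits k) ∷ small ,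
    trans (cong (λ v → foldl pushBit v bs) horner-eq) v
    where
    length-k : length k ≡ w
    length-k = trans (sym (+-identityʳ (length k))) k-length

    regroup : ∀ v b h → v + b * h ≡ h * b + v
    regroup = solve-∀

    horner-eq : horner (2 ^ w) (k ∷ blocks) ≡ horner (2 ^ w) blocks * 2 ^ length k + value (encodeBits k)
    horner-eq = trans (regroup (value (encodeBits k)) (2 ^ w) (horner (2 ^ w) blocks))
      (cong (λ w′ → horner (2 ^ w) blocks * 2 ^ w′ + value (encodeBits k)) (sym length-k))

  abstract
    chopStep-runs : ∀ {V y ys blocks k bs} → ChopInvariant V (y ∷ ys) (blocks , k , bs) → ∃[ a ]
      (chopStep ⊢ chopStore (y ∙ spine ys) [] blocks (k , bs)
         ⇒ chopStore (spine ys) [] (proj₁ a) (proj₂ a) ⟪ 15 + blockTime n ⟫)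
      × ChopInvariant V ys a
    chopStep-runs {V} {y} {ys} {blocks} {k} {bs} (blocks-length , bs-length , small , v) =
      let (k′ , bs′) , run , i = takeBlock-runs (y ∙ spine ys) blocks (length ys * w) (horner (2 ^ w) blocks) V bs
            (refl , bs-length ,
             trans (cong (λ v → foldl pushBit v bs) (trans (+-identityʳ _) (*-identityʳ (horner (2 ^ w) blocks)))) v)
      in (k′ ∷ blocks , k′ , bs′) ,
         weaken (≤-reflexive (collect (blockTime n))) (set ⨟ set ⨟ run ⨟ set ⨟ set) ,
         chopInvariant-step {V} {ys} {blocks} {k′} {bs′} blocks-length small i
      where
      collect : ∀ u → 7 + (u + 8) ≡ 15 + u
      collect = solve-∀

    chop-runs : ∀ bs → length bs ≡ w * w → ∃[ blocks ] ∃[ a ]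
      (chop ⊢ mainStore rs ls nil nil nil [] nil nil (encodeBits bs) ⇒ chopStore nil [] blocks a ⟪ chopTime n ⟫)
      × length blocks ≡ w × All (λ k → value (encodeBits k) < 2 ^ w) blocks
      × horner (2 ^ w) blocks ≡ foldl pushBit 0 bs
    chop-runs bs bs-length =
      let (blocks , a) , run , blocks-length , a-length , small , v =
            forEach {e = var 2F} (λ { ys (blocks , a) → chopStore (spine ys) [] blocks a })
              (ChopInvariant (foldl pushBit 0 bs)) refl (λ ()) chopStep-runs
              (nil ∷ rs) {[] , [] , bs} (refl , bs-length , [] , refl)
      in blocks , a , (set ⨟ run) , trans (sym (+-identityʳ _)) blocks-length , small , finished a a-length v
      where
      finished : ∀ {h V} (a : List Bool × List Bool) → length (proj₂ a) ≡ 0 → foldl pushBit h (proj₂ a) ≡ V → h ≡ V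
      finished (_ , []) _ v = v

-- The whole program.

nbhdPolyProgram : Program
nbhdPolyProgram = program (setup ⨾ allRounds ⨾ gather ⨾ chop)

programTime : ℕ → ℕ → ℕ → ℕ
programTime n l S =
  1 + setupTime n + (1 + (n * (2 + roundTime n l S) + 2) + (1 + gatherTime n l S + chopTime n))

module _ (rs : List Tree) (S : ℕ) (Key : Subset (length rs) → Set) where

  private
    n w : ℕ
    n = length rs
    w = suc n

    ls : List Tree
    ls = List.replicate (w * w) nil

    ls-length : length ls ≡ w * w
    ls-length = length-replicate (w * w)

    T₀ : Table
    T₀ = (ones rs , (nil ∙ nil) ∙ nil) ∷ []

  module _ (bounded : ∀ {T} → Valid rs ls S Key T → length T ≤ S) (⊤-key : Key ⊤)
           (closed : All (ClosedUnder rs ls S Key bounded) rs)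
           (small : extensions (2 ^ w) rs (λ _ → 1) (⊤ {n}) < 2 ^ (w * w)) where

    private
      sets : Subset n → ℕ
      sets = extensions (2 ^ w) rs (λ _ → 1)

      T₀-weight : ∀ φ → weight n φ T₀ ≡ φ ⊤
      T₀-weight φ = trans (+-identityʳ _) (trans (*-identityʳ _) (cong φ (members-full n false nil nil)))

      T₀-valid : Valid rs ls S Key T₀
      T₀-valid = valid ([] ∷ []) (subst Key (sym (members-full n false nil nil)) ⊤-key ∷ [])

      bound : extensions (2 ^ w) rs (λ _ → 1) ⊤ < 2 ^ length ls
      bound = subst (λ l → sets ⊤ < 2 ^ l) (sym ls-length) small

      chain : ∀ {T bs blocks a} →
        allRounds ⊢ mainStore rs ls (spine rs) (encodeTable T₀) nil [] nil nil nil
          ⇒ mainStore rs ls nil (encodeTable T) nil [] nil nil nil ⟪ n * (2 + roundTime n (length ls) S) + 2 ⟫ →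
        gather ⊢ mainStore rs ls nil (encodeTable T) nil [] nil nil nil
          ⇒ mainStore rs ls nil nil nil [] nil nil (encodeBits bs) ⟪ gatherTime n (length ls) S ⟫ →
        chop ⊢ mainStore rs ls nil nil nil [] nil nil (encodeBits bs)
          ⇒ chopStore rs nil [] blocks a ⟪ chopTime n ⟫ →
        Program.body nbhdPolyProgram ⊢ spine rs ∷ᵛ Vec.replicate 15 nil ⇒ chopStore rs nil [] blocks a
          ⟪ programTime n (length ls) S ⟫
      chain r s t = setup-runs rs ⨟ (r ⨟ (s ⨟ t))

    program-runs : ∃[ blocks ] ∃[ a ]
      (Program.body nbhdPolyProgram ⊢ spine rs ∷ᵛ Vec.replicate 15 nil ⇒ chopStore rs nil [] blocks a
         ⟪ programTime n (w * w) S ⟫)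
      × length blocks ≡ w × All (λ k → value (encodeBits k) < 2 ^ w) blocks
      × horner (2 ^ w) blocks ≡ extensions (2 ^ w) rs (bit ∘ inhabited) ⊤
    program-runs =
      let T , run , weights , T-valid = allRounds-runs rs ls S Key bounded T₀ T₀-valid rs closed
            (subst (_< 2 ^ length ls) (sym (T₀-weight sets)) bound)
          os , run′ , os-length , os-value = gather-runs rs (bounded T-valid)
            (subst (_< 2 ^ length ls)
              (sym (trans (total≡weight n T) (trans (weights (λ _ → 1)) (T₀-weight sets)))) bound)
          blocks , a , run″ , blocks-length , blocks-small , blocks-value =
            chop-runs rs (reverse os) (trans (length-reverse os) (trans os-length ls-length))
      in blocks , a ,
         weaken (≤-reflexive (cong (λ l → programTime n l S) ls-length)) (chain run run′ run″) ,
         blocks-length , blocks-small ,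
         -- The weight equation that gave the overflow bound for φ = 1 is now used for the indicator
         -- of nonempty keys.
         trans blocks-value (trans (pushBits-reverse os) (trans os-value
           (trans (weights (bit ∘ inhabited)) (T₀-weight (extensions (2 ^ w) rs (bit ∘ inhabited))))))

-- The result as a sum over all sets of vertices.

members-toList : ∀ {n} (p : Subset n) → members n (encodeBits (toList p)) ≡ p
members-toList []ᵛ      = refl
members-toList (b ∷ᵛ p) = cong₂ _∷ᵛ_ (truth-encodeBool b) (members-toList p)

subsetSum : ∀ {m} → (Subset m → ℕ) → ℕ
subsetSum f = sum (map f (subsets _))

sum-map-cong : ∀ {A : Set} {f g : A → ℕ} → (∀ x → f x ≡ g x) → ∀ xs → sum (map f xs) ≡ sum (map g xs)
sum-map-cong f≗g []       = refl
sum-map-cong f≗g (x ∷ xs) = cong₂ _+_ (f≗g x) (sum-map-cong f≗g xs)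

sum-map-* : ∀ {A : Set} c (f : A → ℕ) xs → sum (map (λ x → c * f x) xs) ≡ c * sum (map f xs)
sum-map-* c f []       = sym (*-zeroʳ c)
sum-map-* c f (x ∷ xs) = trans (cong (c * f x +_) (sum-map-* c f xs)) (sym (*-distribˡ-+ c (f x) _))

subsetSum-suc : ∀ {m} (f : Subset (suc m) → ℕ) →
  subsetSum f ≡ subsetSum (f ∘ (outside ∷ᵛ_)) + subsetSum (f ∘ (inside ∷ᵛ_))
subsetSum-suc {m} f = begin
  sum (map f (map (outside ∷ᵛ_) (subsets m) ++ map (inside ∷ᵛ_) (subsets m)))
    ≡⟨ cong sum (map-++ f (map (outside ∷ᵛ_) (subsets m)) _) ⟩
  sum (map f (map (outside ∷ᵛ_) (subsets m)) ++ map f (map (inside ∷ᵛ_) (subsets m)))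
    ≡⟨ sum-++ (map f (map (outside ∷ᵛ_) (subsets m))) _ ⟩
  sum (map f (map (outside ∷ᵛ_) (subsets m))) + sum (map f (map (inside ∷ᵛ_) (subsets m)))
    ≡⟨ cong₂ (λ xs ys → sum xs + sum ys) (map-∘ (subsets m)) (map-∘ (subsets m)) ⟨
  subsetSum (f ∘ (outside ∷ᵛ_)) + subsetSum (f ∘ (inside ∷ᵛ_)) ∎
  where open ≡-Reasoning

intersect : ∀ {m n} → (Fin m → Subset n) → Subset n → Subset m → Subset n
intersect g C []ᵛ          = C
intersect g C (false ∷ᵛ A) = intersect (g ∘ suc) C A
intersect g C (true  ∷ᵛ A) = intersect (g ∘ suc) (C ∩ g zero) A

∈-intersect⁺ : ∀ {m n} (g : Fin m → Subset n) {C} A {v} → v ∈ C → (∀ {i} → i ∈ A → v ∈ g i) → v ∈ intersect g C A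
∈-intersect⁺ g []ᵛ          v∈C p = v∈C
∈-intersect⁺ g (false ∷ᵛ A) v∈C p = ∈-intersect⁺ (g ∘ suc) A v∈C (p ∘ there)
∈-intersect⁺ g (true  ∷ᵛ A) v∈C p = ∈-intersect⁺ (g ∘ suc) A (x∈p∩q⁺ (v∈C , p here)) (p ∘ there)

∈-intersect⁻ : ∀ {m n} (g : Fin m → Subset n) {C} A {v} → v ∈ intersect g C A → v ∈ C × (∀ {i} → i ∈ A → v ∈ g i)
∈-intersect⁻ g []ᵛ          v∈ = v∈ , λ ()
∈-intersect⁻ g (false ∷ᵛ A) v∈ with v∈C , p ← ∈-intersect⁻ (g ∘ suc) A v∈ = v∈C , λ { (there i∈A) → p i∈A }
∈-intersect⁻ g {C} (true ∷ᵛ A) v∈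
  with v∈∩ , p ← ∈-intersect⁻ (g ∘ suc) A v∈
  with v∈C , v∈g ← x∈p∩q⁻ C (g zero) v∈∩ = v∈C , λ { here → v∈g ; (there i∈A) → p i∈A }

-- Both sides split in the same way according to whether the first vertex belongs to `A`.
extensions-subsetSum : ∀ {m n} B (φ : Subset n → ℕ) (g : Fin m → Subset n) C →
  extensions B (List.tabulate (encodeBits ∘ toList ∘ g)) φ C ≡ subsetSum (λ A → φ (intersect g C A) * B ^ ∣ A ∣)
extensions-subsetSum {zero}  B φ g C = sym (trans (+-identityʳ _) (*-identityʳ (φ C)))
extensions-subsetSum {suc m} B φ g C = begin
  extensions B rows φ C + B * extensions B rows φ (C ∩ members _ (encodeBits (toList (g zero))))
    ≡⟨ cong (λ R → extensions B rows φ C + B * extensions B rows φ (C ∩ R)) (members-toList (g zero)) ⟩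
  extensions B rows φ C + B * extensions B rows φ (C ∩ g zero)
    ≡⟨ cong₂ (λ x y → x + B * y) (extensions-subsetSum B φ (g ∘ suc) C)
         (extensions-subsetSum B φ (g ∘ suc) (C ∩ g zero)) ⟩
  subsetSum (term C) + B * subsetSum (term (C ∩ g zero))
    ≡⟨ cong (subsetSum (term C) +_) (sum-map-* B (term (C ∩ g zero)) (subsets m)) ⟨
  subsetSum (term C) + subsetSum (λ A → B * term (C ∩ g zero) A)
    ≡⟨ cong (subsetSum (term C) +_) (sum-map-cong
         (λ A → exchange B (φ (intersect (g ∘ suc) (C ∩ g zero) A)) (B ^ ∣ A ∣)) (subsets m)) ⟩
  subsetSum (term C) + subsetSum (λ A → φ (intersect g C (inside ∷ᵛ A)) * B ^ suc ∣ A ∣)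
    ≡⟨ subsetSum-suc (λ A → φ (intersect g C A) * B ^ ∣ A ∣) ⟨
  subsetSum (λ A → φ (intersect g C A) * B ^ ∣ A ∣) ∎
  where
  open ≡-Reasoning
  rows = List.tabulate (encodeBits ∘ toList ∘ g ∘ suc)
  term = λ C A → φ (intersect (g ∘ suc) C A) * B ^ ∣ A ∣
  exchange : ∀ b x y → b * (x * y) ≡ x * (b * y)
  exchange = solve-∀

-- The binomial theorem for the sum of B^|A| over all sets A of rows. It gives the total of the last
-- table, the largest number that can occur.
extensions-one : ∀ {n} B rs (C : Subset n) → extensions B rs (λ _ → 1) C ≡ (1 + B) ^ length rs
extensions-one B []       C = refl
extensions-one B (r ∷ rs) C = cong₂ (λ x y → x + B * y) (extensions-one B rs C) (extensions-one B rs (C ∩ _))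

inhabited⁺ : ∀ {n} (C : Subset n) → Nonempty C → inhabited C ≡ true
inhabited⁺ (true  ∷ᵛ C) _               = refl
inhabited⁺ (false ∷ᵛ C) (suc v , there p) = inhabited⁺ C (v , p)

inhabited⁻ : ∀ {n} (C : Subset n) → inhabited C ≡ true → Nonempty C
inhabited⁻ (true  ∷ᵛ C) p = zero , here
inhabited⁻ (false ∷ᵛ C) p with v , v∈C ← inhabited⁻ C p = suc v , there v∈C

-- Polynomials and their values.

evaluate : ∀ {m} → ℕ → Poly m → ℕ
evaluate B []ᵛ      = 0
evaluate B (c ∷ᵛ p) = c + B * evaluate B p

evaluate-0 : ∀ m B → evaluate B (Vec.replicate m 0) ≡ 0
evaluate-0 zero    B = refl
evaluate-0 (suc m) B = trans (cong (B *_) (evaluate-0 m B)) (*-zeroʳ B)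

evaluate-+ : ∀ {m} B (p q : Poly m) → evaluate B (zipWith _+_ p q) ≡ evaluate B p + evaluate B q
evaluate-+ B []ᵛ      []ᵛ      = refl
evaluate-+ B (c ∷ᵛ p) (d ∷ᵛ q) = trans (cong (λ v → c + d + B * v) (evaluate-+ B p q)) (regroup c d B _ (evaluate B q))
  where
  regroup : ∀ c d b x y → c + d + b * (x + y) ≡ c + b * x + (d + b * y)
  regroup = solve-∀

evaluate-x^ : ∀ {m} B (i : Fin m) → evaluate B (x^ i) ≡ B ^ toℕ i
evaluate-x^ {suc m} B zero    = cong suc (trans (cong (B *_) (evaluate-0 m B)) (*-zeroʳ B))
evaluate-x^         B (suc i) = cong (B *_) (evaluate-x^ B i)

evaluate-sumPoly : ∀ {m} B (ps : List (Poly m)) → evaluate B (sumPoly ps) ≡ sum (map (evaluate B) ps)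
evaluate-sumPoly {m} B []       = evaluate-0 m B
evaluate-sumPoly     B (p ∷ ps) = trans (evaluate-+ B p (sumPoly ps)) (cong (evaluate B p +_) (evaluate-sumPoly B ps))

-- The value at 1 is the sum of the coefficients.
coefficients≤ : ∀ {m} (p : Poly m) → Allᵛ (_≤ evaluate 1 p) p
coefficients≤ []ᵛ      = []ᵃ
coefficients≤ (c ∷ᵛ p) = m≤m+n c _ ∷ᵃ
  Allᵛ.map (λ d≤ → ≤-trans d≤ (≤-trans (≤-reflexive (sym (*-identityˡ _))) (m≤n+m _ c))) (coefficients≤ p)

-- Uniqueness of digits in base `B`: the first one is the residue modulo `B`, and after cancelling
-- it the rest can be divided by `B`.
evaluate-injective : ∀ {m} B .{{_ : NonZero B}} {p q : Poly m} → Allᵛ (_< B) p → Allᵛ (_< B) q →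
                     evaluate B p ≡ evaluate B q → p ≡ q
evaluate-injective B {[]ᵛ}    {[]ᵛ}    _          _          eq = refl
evaluate-injective B {c ∷ᵛ p} {d ∷ᵛ q} (c<B ∷ᵃ p<B) (d<B ∷ᵃ q<B) eq =
  cong₂ _∷ᵛ_ c≡d (evaluate-injective B p<B q<B
    (*-cancelˡ-≡ _ _ B (+-cancelˡ-≡ d _ _ (trans (cong (_+ B * evaluate B p) (sym c≡d)) eq))))
  where
  open ≡-Reasoning
  digit : ∀ c x → c < B → (c + B * x) % B ≡ c
  digit c x c<B = trans (cong (λ y → (c + y) % B) (*-comm B x)) (trans ([m+kn]%n≡m%n c x B) (m<n⇒m%n≡m c<B))

  c≡d : c ≡ d
  c≡d = trans (sym (digit c _ c<B)) (trans (cong (_% B) eq) (digit d _ d<B))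

sum-filter : ∀ {A : Set} {P : A → Set} (P? : ∀ x → Dec (P x)) (f : A → ℕ) xs →
             sum (map f (filter P? xs)) ≡ sum (map (λ x → bit (does (P? x)) * f x) xs)
sum-filter P? f []       = refl
sum-filter P? f (x ∷ xs) with does (P? x)
... | true  = cong₂ _+_ (sym (+-identityʳ (f x))) (sum-filter P? f xs)
... | false = sum-filter P? f xs

length-subsets : ∀ n → length (subsets n) ≡ 2 ^ n
length-subsets zero    = refl
length-subsets (suc n) = begin
  length (map (outside ∷ᵛ_) (subsets n) ++ map (inside ∷ᵛ_) (subsets n))
    ≡⟨ length-++ (map (outside ∷ᵛ_) (subsets n)) ⟩
  length (map (outside ∷ᵛ_) (subsets n)) + length (map (inside ∷ᵛ_) (subsets n))
    ≡⟨ cong₂ _+_ (length-map _ (subsets n)) (length-map _ (subsets n)) ⟩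
  length (subsets n) + length (subsets n)
    ≡⟨ cong₂ _+_ (length-subsets n) (trans (length-subsets n) (sym (+-identityʳ _))) ⟩
  2 ^ suc n ∎
  where open ≡-Reasoning

-- The neighborhood complex in terms of common neighborhoods.

∈-tabulate⁺ : ∀ {n} {f : Fin n → Bool} {v} → f v ≡ true → v ∈ tabulate f
∈-tabulate⁺ {f = f} {v} p = lookup⇒[]= v _ (trans (lookup∘tabulate f v) p)

∈-tabulate⁻ : ∀ {n} {f : Fin n → Bool} {v} → v ∈ tabulate f → f v ≡ true
∈-tabulate⁻ {f = f} {v} p = trans (sym (lookup∘tabulate f v)) ([]=⇒lookup p)

module _ (G : Graph) where

  open Graph G using (adj; nbhd) renaming (sym to adj-sym)

  ∈-nbhd-sym : ∀ {u v} → v ∈ nbhd u → u ∈ nbhd v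
  ∈-nbhd-sym {u} {v} p = ∈-tabulate⁺ (trans (adj-sym v u) (∈-tabulate⁻ p))

  -- By symmetry of adjacency, v lies in N(u) for all u in A exactly if A is contained in N(v).
  inhabited-intersect : ∀ A → inhabited (intersect nbhd ⊤ A) ≡ does (inNbhdComplex? G A)
  inhabited-intersect A with inNbhdComplex? G A
  ... | yes (v , A⊆Nv) = inhabited⁺ _ (v , ∈-intersect⁺ nbhd A ∈⊤ (λ u∈A → ∈-nbhd-sym (A⊆Nv u∈A)))
  ... | no ¬p with inhabited (intersect nbhd ⊤ A) in eq
  ...   | false = refl
  ...   | true with v , v∈ ← inhabited⁻ _ eq =
    contradiction (v , λ {u} u∈A → ∈-nbhd-sym (proj₂ (∈-intersect⁻ nbhd A v∈) u∈A)) ¬p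

  private
    n = order G

  evaluate-nbhdPoly : ∀ B →
    evaluate B (nbhdPoly G) ≡ sum (map (λ A → B ^ ∣ A ∣) (filter (inNbhdComplex? G) (subsets n)))
  evaluate-nbhdPoly B = begin
    evaluate B (nbhdPoly G)
      ≡⟨ evaluate-sumPoly B (map _ complex) ⟩
    sum (map (evaluate B) (map _ complex))
      ≡⟨ cong sum (map-∘ complex) ⟨
    sum (map (λ A → evaluate B (x^ (fromℕ< (s≤s (∣p∣≤n A))))) complex)
      ≡⟨ sum-map-cong (λ A → trans (evaluate-x^ B (fromℕ< (s≤s (∣p∣≤n A)))) 
                              (cong (B ^_) (toℕ-fromℕ< (s≤s (∣p∣≤n A))))) complex ⟩
    sum (map (λ A → B ^ ∣ A ∣) complex) ∎
    where
    open ≡-Reasoning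
    complex = filter (inNbhdComplex? G) (subsets n)

  rows : List Tree
  rows = List.tabulate (encodeBits ∘ toList ∘ nbhd)

  extensions-nbhdPoly : ∀ B → extensions B rows (bit ∘ inhabited) ⊤ ≡ evaluate B (nbhdPoly G)
  extensions-nbhdPoly B = begin
    extensions B rows (bit ∘ inhabited) ⊤
      ≡⟨ extensions-subsetSum B (bit ∘ inhabited) nbhd ⊤ ⟩
    subsetSum (λ A → bit (inhabited (intersect nbhd ⊤ A)) * B ^ ∣ A ∣)
      ≡⟨ sum-map-cong (λ A → cong (λ b → bit b * B ^ ∣ A ∣) (inhabited-intersect A)) (subsets n) ⟩
    subsetSum (λ A → bit (does (inNbhdComplex? G A)) * B ^ ∣ A ∣)
      ≡⟨ sum-filter (inNbhdComplex? G) (λ A → B ^ ∣ A ∣) (subsets n) ⟨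
    sum (map (λ A → B ^ ∣ A ∣) (filter (inNbhdComplex? G) (subsets n)))
      ≡⟨ evaluate-nbhdPoly B ⟨
    evaluate B (nbhdPoly G) ∎
    where open ≡-Reasoning

  -- The value at 1 counts the sets of the complex, of which there are at most 2^n. Thus every
  -- coefficient is a digit in base 2^(n+1).
  nbhdPoly-small : Allᵛ (_< 2 ^ suc n) (nbhdPoly G)
  nbhdPoly-small = Allᵛ.map (λ c≤ → ≤-<-trans (≤-trans c≤ bound) (^-monoʳ-< 2 (s≤s (s≤s z≤n)) (n<1+n n)))
                            (coefficients≤ (nbhdPoly G))
    where
    sum-ones : ∀ {A : Set} (f : A → ℕ) xs → sum (map (λ x → 1 ^ f x) xs) ≡ length xs
    sum-ones f []       = refl
    sum-ones f (x ∷ xs) = cong₂ _+_ (^-zeroˡ (f x)) (sum-ones f xs)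

    bound : evaluate 1 (nbhdPoly G) ≤ 2 ^ n
    bound = begin
      evaluate 1 (nbhdPoly G)
        ≡⟨ evaluate-nbhdPoly 1 ⟩
      sum (map (λ A → 1 ^ ∣ A ∣) (filter (inNbhdComplex? G) (subsets n)))
        ≡⟨ sum-ones ∣_∣ (filter (inNbhdComplex? G) (subsets n)) ⟩
      length (filter (inNbhdComplex? G) (subsets n))
        ≤⟨ length-filter (inNbhdComplex? G) (subsets n) ⟩
      length (subsets n)
        ≡⟨ length-subsets n ⟩
      2 ^ n ∎
      where open ≤-Reasoning

-- Counting common neighborhoods.

unique-length-≤ : ∀ {A : Set} {xs ys : List A} → Unique xs → All (_∈ˡ ys) xs → length xs ≤ length ys
unique-length-≤ []           []           = z≤n
unique-length-≤ {xs = x ∷ xs} (x∉xs ∷ xs!) (x∈ys ∷ xs⊆ys)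
  with ys₁ , ys₂ , refl ← ∈-∃++ x∈ys =
  subst (suc (length xs) ≤_) (sym (length-++-sucʳ ys₁ x ys₂))
    (s≤s (unique-length-≤ xs! (All.zipWith (λ (x≢y , y∈) → drop x≢y (∈-++⁻ ys₁ y∈)) (x∉xs , xs⊆ys))))
  where
  drop : ∀ {y} → x ≢ y → y ∈ˡ ys₁ ⊎ y ∈ˡ x ∷ ys₂ → y ∈ˡ ys₁ ++ ys₂
  drop x≢y (inj₁ p)           = ∈-++⁺ˡ p
  drop x≢y (inj₂ (here refl)) = contradiction refl x≢y
  drop x≢y (inj₂ (there p))   = ∈-++⁺ʳ ys₁ p

smallSubsets : ∀ n → ℕ → List (Subset n)
smallSubsets zero    k       = []ᵛ ∷ []
smallSubsets (suc n) zero    = map (outside ∷ᵛ_) (smallSubsets n zero)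
smallSubsets (suc n) (suc k) = map (outside ∷ᵛ_) (smallSubsets n (suc k)) ++ map (inside ∷ᵛ_) (smallSubsets n k)

∈-smallSubsets : ∀ {n k} (A : Subset n) → ∣ A ∣ ≤ k → A ∈ˡ smallSubsets n k
∈-smallSubsets {zero}          []ᵛ          p       = here refl
∈-smallSubsets {suc n} {zero}  (false ∷ᵛ A) p       = ∈-map⁺ _ (∈-smallSubsets A p)
∈-smallSubsets {suc n} {suc k} (false ∷ᵛ A) p       = ∈-++⁺ˡ (∈-map⁺ _ (∈-smallSubsets A p))
∈-smallSubsets {suc n} {suc k} (true  ∷ᵛ A) (s≤s p) =
  ∈-++⁺ʳ (map (outside ∷ᵛ_) (smallSubsets n (suc k))) (∈-map⁺ _ (∈-smallSubsets A p))

-- Pascal's recursion leads to (n+1)^(k+1) + (n+1)^k = (n+2) (n+1)^k, which is at most (n+2)^(k+1).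
length-smallSubsets : ∀ n k → length (smallSubsets n k) ≤ suc n ^ k
length-smallSubsets zero    k       = ≤-reflexive (sym (^-zeroˡ k))
length-smallSubsets (suc n) zero    =
  ≤-trans (≤-reflexive (length-map _ (smallSubsets n zero))) (length-smallSubsets n zero)
length-smallSubsets (suc n) (suc k) = begin
  length (map (outside ∷ᵛ_) (smallSubsets n (suc k)) ++ map (inside ∷ᵛ_) (smallSubsets n k))
    ≡⟨ length-++ (map (outside ∷ᵛ_) (smallSubsets n (suc k))) ⟩
  length (map (outside ∷ᵛ_) (smallSubsets n (suc k))) + length (map (inside ∷ᵛ_) (smallSubsets n k))
    ≡⟨ cong₂ _+_ (length-map _ (smallSubsets n (suc k))) (length-map _ (smallSubsets n k)) ⟩
  length (smallSubsets n (suc k)) + length (smallSubsets n k)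
    ≤⟨ +-mono-≤ (length-smallSubsets n (suc k)) (length-smallSubsets n k) ⟩
  suc n * suc n ^ k + suc n ^ k
    ≡⟨ +-comm (suc n * suc n ^ k) _ ⟩
  suc (suc n) * suc n ^ k
    ≤⟨ *-monoʳ-≤ (suc (suc n)) (^-monoˡ-≤ k (n≤1+n (suc n))) ⟩
  suc (suc n) ^ suc k ∎
  where open ≤-Reasoning

module _ (G : Graph) where

  open Graph G using (adj; nbhd) renaming (sym to adj-sym)

  private
    n = order G

  common : Subset n → Subset n
  common A = tabulate λ v → does (A ⊆? nbhd v)

  ∈-common⁺ : ∀ {A v} → A ⊆ nbhd v → v ∈ common A
  ∈-common⁺ {A} {v} p = ∈-tabulate⁺ (dec-true (A ⊆? nbhd v) p)

  ∈-common⁻ : ∀ A {v} → v ∈ common A → A ⊆ nbhd v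
  ∈-common⁻ A {v} v∈ with A ⊆? nbhd v | ∈-tabulate⁻ v∈
  ... | yes p | _ = p

  common-⊥ : common ⊥ ≡ ⊤
  common-⊥ = ⊆-antisym (λ _ → ∈⊤) (λ _ → ∈-common⁺ (λ u∈⊥ → contradiction u∈⊥ ∉⊥))

  -- With `common-⊥` this makes every key of every table a common neighborhood: scanning v replaces
  -- `A` by `A ∪ ⁅ v ⁆`.
  common-∪ : ∀ A v → common (A ∪ ⁅ v ⁆) ≡ common A ∩ nbhd v
  common-∪ A v = ⊆-antisym
    (λ w∈ → x∈p∩q⁺ (∈-common⁺ (λ u∈A → ∈-common⁻ (A ∪ ⁅ v ⁆) w∈ (x∈p∪q⁺ (inj₁ u∈A)))
                   , ∈-nbhd-sym G (∈-common⁻ (A ∪ ⁅ v ⁆) w∈ (x∈p∪q⁺ {p = A} (inj₂ (x∈⁅x⁆ v))))))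
    (λ w∈ → let w∈A , w∈v = x∈p∩q⁻ (common A) (nbhd v) w∈ in
       ∈-common⁺ λ u∈ → adjacent w∈A w∈v (x∈p∪q⁻ A ⁅ v ⁆ u∈))
    where
    adjacent : ∀ {u w} → w ∈ common A → w ∈ nbhd v → u ∈ A ⊎ u ∈ ⁅ v ⁆ → u ∈ nbhd w
    adjacent w∈A w∈v (inj₁ u∈A) = ∈-common⁻ A w∈A u∈A
    adjacent w∈A w∈v (inj₂ u∈v) with refl ← x∈⁅y⁆⇒x≡y v u∈v = ∈-nbhd-sym G w∈v

  module _ (A : Subset n) where

    Across : Fin n → Fin n → Set
    Across u v = (u ∈ A × v ∈ common A) ⊎ (v ∈ A × u ∈ common A)

    across? : ∀ u v → Dec (Across u v)
    across? u v = ((u ∈? A) ×-dec (v ∈? common A)) ⊎-dec ((v ∈? A) ×-dec (u ∈? common A))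

    private
      adjacent : ∀ {u v} → Across u v → adj u v ≡ true
      adjacent {u} {v} (inj₁ (u∈A , v∈)) = trans (adj-sym u v) (∈-tabulate⁻ (∈-common⁻ A v∈ u∈A))
      adjacent         (inj₂ (v∈A , u∈)) = ∈-tabulate⁻ (∈-common⁻ A u∈ v∈A)

      ends : ∀ {u v} → Across u v → u ∈ A ∪ common A × v ∈ A ∪ common A
      ends (inj₁ (u∈A , v∈)) = x∈p∪q⁺ (inj₁ u∈A) , x∈p∪q⁺ (inj₂ v∈)
      ends (inj₂ (v∈A , u∈)) = x∈p∪q⁺ (inj₂ u∈) , x∈p∪q⁺ (inj₁ v∈A)

      true⇒ : ∀ {P : Set} (p? : Dec P) → does p? ≡ true → P
      true⇒ (yes p) _ = p

    biclique : Subgraph G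
    biclique = record
      { verts     = A ∪ common A
      ; adjˢ      = λ u v → does (across? u v)
      ; symˢ      = λ u v → does-⇔ (mk⇔ swap swap) (across? u v) (across? v u)
      ; adjˢ⊆adj  = λ u v p → adjacent (true⇒ (across? u v) p)
      ; endpoints = λ u v p → ends (true⇒ (across? u v) p)
      }

  module _ {k : ℕ} (degenerate : Degenerate k G) where

    open Degenerate degenerate using (lowDegree)

    -- A and its common neighbours span a complete bipartite graph, and
    -- K_{k+1,k+1} is not k-degenerate.
    common-small : ∀ A → ∣ A ∣ ≤ k ⊎ ∣ common A ∣ ≤ k
    common-small A with nonempty? A
    ... | no  A-empty = inj₁ (≤-trans (≤-reflexive (trans (cong ∣_∣ (Empty-unique A-empty)) (∣⊥∣≡0 n))) z≤n)
    ... | yes (u , u∈A) with lowDegree (biclique A) (u , x∈p∪q⁺ (inj₁ u∈A))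
    ...   | v , v∈ , low with x∈p∪q⁻ A (common A) v∈
    ...     | inj₁ v∈A = inj₂ (≤-trans (p⊆q⇒∣p∣≤∣q∣ λ {w} w∈ →
                            ∈-tabulate⁺ (dec-true (across? A v w) (inj₁ (v∈A , w∈)))) low)
    ...     | inj₂ v∈C = inj₁ (≤-trans (p⊆q⇒∣p∣≤∣q∣ λ {w} w∈ →
                            ∈-tabulate⁺ (dec-true (across? A v w) (inj₂ (w∈ , v∈C)))) low)

    few-common : ∀ {Cs} → Unique Cs → All (λ C → ∃[ A ] C ≡ common A) Cs → length Cs ≤ suc n ^ k + suc n ^ k
    few-common {Cs} Cs! all-common = begin
      length Cs                                                ≤⟨ unique-length-≤ Cs! (All.map listed all-common) ⟩
      length (smallSubsets n k ++ map common (smallSubsets n k)) ≡⟨ length-++ (smallSubsets n k) ⟩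
      length (smallSubsets n k) + length (map common (smallSubsets n k))
        ≡⟨ cong (length (smallSubsets n k) +_) (length-map common (smallSubsets n k)) ⟩
      length (smallSubsets n k) + length (smallSubsets n k)
        ≤⟨ +-mono-≤ (length-smallSubsets n k) (length-smallSubsets n k) ⟩
      suc n ^ k + suc n ^ k ∎
      where
      open ≤-Reasoning
      listed : ∀ {C} → ∃[ A ] C ≡ common A → C ∈ˡ smallSubsets n k ++ map common (smallSubsets n k)
      listed (A , refl) with common-small A
      ... | inj₁ A-small = ∈-++⁺ʳ (smallSubsets n k) (∈-map⁺ common (∈-smallSubsets A A-small))
      ... | inj₂ C-small = ∈-++⁺ˡ (∈-smallSubsets (common A) C-small)

-- Since 1 + 2^(n+1) is at most 2^(n+2), the exponent (n+2) n = (n+1)^2 - 1 suffices; the ruler is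
-- just long enough for this estimate.
powers-fit : ∀ n → (1 + 2 ^ suc n) ^ n < 2 ^ (suc n * suc n)
powers-fit n = begin-strict
  (1 + 2 ^ suc n) ^ n         ≤⟨ ^-monoˡ-≤ n (+-monoˡ-≤ (2 ^ suc n) (m^n>0 2 (suc n))) ⟩
  (2 ^ suc n + 2 ^ suc n) ^ n ≡⟨ cong (λ x → (2 ^ suc n + x) ^ n) (sym (+-identityʳ (2 ^ suc n))) ⟩
  (2 ^ (2 + n)) ^ n           ≡⟨ ^-*-assoc 2 (2 + n) n ⟩
  2 ^ ((2 + n) * n)           <⟨ ^-monoʳ-< 2 (s≤s (s≤s z≤n)) (≤-reflexive (square n)) ⟩
  2 ^ (suc n * suc n)         ∎
  where
  open ≤-Reasoning
  square : ∀ n → 1 + (2 + n) * n ≡ (1 + n) * (1 + n)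
  square = solve-∀

-- In `program-runs` the sets live over `length rs`. Here they live over an `n` that merely equals
-- this length, as `order G` does for `rows G`.
program-correct : ∀ {n} rs → length rs ≡ n → ∀ {S} {Key : Subset n → Set} →
  (∀ {Cs} → Unique Cs → All Key Cs → length Cs ≤ S) →
  Key ⊤ → All (λ r → ∀ {C} → Key C → Key (C ∩ members n r)) rs →
  ∃[ blocks ] ∃[ a ]
  (Program.body nbhdPolyProgram ⊢ spine rs ∷ᵛ Vec.replicate 15 nil ⇒ encodeList encodeBits blocks ∷ᵛ a
     ⟪ programTime n (suc n * suc n) S ⟫)
  × length blocks ≡ suc n × All (λ k → value (encodeBits k) < 2 ^ suc n) blocks
  × horner (2 ^ suc n) blocks ≡ extensions (2 ^ suc n) rs (bit ∘ inhabited) (⊤ {n})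
program-correct rs refl {S} {Key} few ⊤-key closed =
  let blocks , _ , rest = program-runs rs S Key
        (λ {T} T-valid → subst (_≤ S) (length-map (key (length rs)) T)
          (few (AllPairs.map⁺ (Valid.distinct T-valid)) (All.map⁺ (Valid.all-keys T-valid))))
        ⊤-key closed
        (subst (_< 2 ^ (suc (length rs) * suc (length rs)))
          (sym (extensions-one (2 ^ suc (length rs)) rs ⊤)) (powers-fit (length rs)))
  in blocks , _ , rest

-- The output format.

toBit : Bool → Bit
toBit false = zero
toBit true  = suc zero

encode-toBit : ∀ bs → encodeList encodeBit (map toBit bs) ≡ encodeBits bs
encode-toBit []           = refl
encode-toBit (false ∷ bs) = cong (nil ∙_) (encode-toBit bs)
encode-toBit (true  ∷ bs) = cong ((nil ∙ nil) ∙_) (encode-toBit bs)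

fromDigits-toBit : ∀ bs → fromDigits (map toBit bs) ≡ value (encodeBits bs)
fromDigits-toBit []           = refl
fromDigits-toBit (false ∷ bs) = trans (cong (_* 2) (fromDigits-toBit bs)) (*-comm (value (encodeBits bs)) 2)
fromDigits-toBit (true  ∷ bs) = cong suc (trans (cong (_* 2) (fromDigits-toBit bs)) (*-comm (value (encodeBits bs)) 2))

digits : ∀ blocks → Vec (Expansion 2) (length blocks)
digits blocks = Vec.map (map toBit) (fromList blocks)

encode-digits : ∀ blocks → encodeList encodeBits blocks ≡ encodeList (encodeList encodeBit) (toList (digits blocks))
encode-digits []             = refl
encode-digits (bs ∷ blocks) = cong₂ _∙_ (sym (encode-toBit bs)) (encode-digits blocks)

evaluate-digits : ∀ B blocks → evaluate B (Vec.map fromDigits (digits blocks)) ≡ horner B blocks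
evaluate-digits B []            = refl
evaluate-digits B (bs ∷ blocks) = cong₂ (λ c v → c + B * v) (fromDigits-toBit bs) (evaluate-digits B blocks)

digits-small : ∀ {B} blocks → All (λ k → value (encodeBits k) < B) blocks →
  Allᵛ (_< B) (Vec.map fromDigits (digits blocks))
digits-small []            []        = []ᵃ
digits-small (bs ∷ blocks) (b ∷ all) = subst (_< _) (sym (fromDigits-toBit bs)) b ∷ᵃ digits-small blocks all

represents : ∀ {m} B .{{_ : NonZero B}} blocks {p : Poly m} → length blocks ≡ m →
  All (λ k → value (encodeBits k) < B) blocks → Allᵛ (_< B) p → horner B blocks ≡ evaluate B p →
  Represents (encodeList encodeBits blocks) p
represents B blocks refl blocks-small p-small eq =
  digits blocks , encode-digits blocks ,
  evaluate-injective B (digits-small blocks blocks-small) p-small (trans (evaluate-digits B blocks) eq)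

encodeList-tabulate : ∀ {m} {A : Set} (f : A → Tree) (g : Fin m → A) →
  encodeList f (List.tabulate g) ≡ spine (List.tabulate (f ∘ g))
encodeList-tabulate {zero}  f g = refl
encodeList-tabulate {suc m} f g = cong (f (g zero) ∙_) (encodeList-tabulate f (g ∘ suc))

-- Polynomial bounds.

PolyBounded : (ℕ → ℕ) → Set
PolyBounded f = ∃[ c ] ∃[ d ] (∀ n → .{{NonZero n}} → f n ≤ c * n ^ d)

constᵖ : ∀ c → PolyBounded (λ _ → c)
constᵖ c = c , 0 , λ n → ≤-reflexive (sym (*-identityʳ c))

idᵖ : PolyBounded (λ n → n)
idᵖ = 1 , 1 , λ n → ≤-reflexive (sym (trans (*-identityˡ (n ^ 1)) (*-identityʳ n)))

infixl 6 _+ᵖ_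
infixl 7 _*ᵖ_

-- For positive `n`, the exponent `d + d′` dominates both `d` and `d′`, which avoids a maximum.
_+ᵖ_ : ∀ {f g} → PolyBounded f → PolyBounded g → PolyBounded (λ n → f n + g n)
(c , d , p) +ᵖ (c′ , d′ , q) = c + c′ , d + d′ , λ n →
  ≤-trans (+-mono-≤ (≤-trans (p n) (*-monoʳ-≤ c (^-monoʳ-≤ n (m≤m+n d d′))))
                    (≤-trans (q n) (*-monoʳ-≤ c′ (^-monoʳ-≤ n (m≤n+m d′ d)))))
          (≤-reflexive (sym (*-distribʳ-+ (n ^ (d + d′)) c c′)))

_*ᵖ_ : ∀ {f g} → PolyBounded f → PolyBounded g → PolyBounded (λ n → f n * g n)
(c , d , p) *ᵖ (c′ , d′ , q) = c * c′ , d + d′ , λ n →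
  ≤-trans (*-mono-≤ (p n) (q n))
    (≤-reflexive (trans (regroup c (n ^ d) c′ (n ^ d′)) (cong (c * c′ *_) (sym (^-distribˡ-+-* n d d′)))))
  where
  regroup : ∀ a x b y → a * x * (b * y) ≡ a * b * (x * y)
  regroup = solve-∀

_^ᵖ_ : ∀ {f} → PolyBounded f → ∀ k → PolyBounded (λ n → f n ^ k)
p ^ᵖ zero  = constᵖ 1
p ^ᵖ suc k = p *ᵖ (p ^ᵖ k)

programTime-polyBounded : ∀ {f} → PolyBounded f → PolyBounded (λ n → programTime n (suc n * suc n) (f n))
programTime-polyBounded {f} S =
  constᵖ 1 +ᵖ setupᵖ +ᵖ (constᵖ 1 +ᵖ (idᵖ *ᵖ (constᵖ 2 +ᵖ roundᵖ) +ᵖ constᵖ 2) +ᵖ (constᵖ 1 +ᵖ gatherᵖ +ᵖ chopᵖ))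
  where
  w : PolyBounded suc
  w = constᵖ 1 +ᵖ idᵖ

  transducerᵖ : ∀ {g} → PolyBounded g → PolyBounded (λ n → transducerTime (g n))
  transducerᵖ g = g *ᵖ constᵖ 167 +ᵖ constᵖ 14

  stepᵖ : PolyBounded (λ n → stepTime n (suc n * suc n))
  stepᵖ = constᵖ 93 +ᵖ (transducerᵖ idᵖ +ᵖ transducerᵖ (w *ᵖ w))

  insertᵖ : PolyBounded (λ n → insertTime n (suc n * suc n) (f n))
  insertᵖ = constᵖ 15 +ᵖ S *ᵖ stepᵖ

  extendᵖ : PolyBounded (λ n → extendTime n (suc n * suc n) (f n))
  extendᵖ = constᵖ 56 +ᵖ (insertᵖ +ᵖ insertᵖ +ᵖ (transducerᵖ idᵖ +ᵖ (w *ᵖ constᵖ 10 +ᵖ constᵖ 2)))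

  roundᵖ : PolyBounded (λ n → roundTime n (suc n * suc n) (f n))
  roundᵖ = S *ᵖ (constᵖ 2 +ᵖ extendᵖ) +ᵖ constᵖ 12

  setupᵖ : PolyBounded setupTime
  setupᵖ = w *ᵖ (constᵖ 2 +ᵖ (w *ᵖ constᵖ 10 +ᵖ constᵖ 2 +ᵖ constᵖ 7)) +ᵖ transducerᵖ idᵖ +ᵖ constᵖ 37

  gatherᵖ : PolyBounded (λ n → gatherTime n (suc n * suc n) (f n))
  gatherᵖ = constᵖ 29 +ᵖ (S *ᵖ stepᵖ +ᵖ constᵖ 2 +ᵖ transducerᵖ (w *ᵖ w) +ᵖ (w *ᵖ w *ᵖ constᵖ 11 +ᵖ constᵖ 2))

  chopᵖ : PolyBounded chopTime
  chopᵖ = constᵖ 3 +ᵖ (w *ᵖ (constᵖ 2 +ᵖ (constᵖ 15 +ᵖ (w *ᵖ constᵖ 15 +ᵖ constᵖ 2))) +ᵖ constᵖ 2)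

theorem11 : (k : ℕ) → 0 < k →
    Σ[ p ∈ Program ] ∃[ c ] ∃[ d ]
    ((G : Graph) → Degenerate k G →
    ∃[ b ] ∃[ t ]
    (p on encodeGraph G gives b in-time t)
    × Represents b (nbhdPoly G)
    × t ≤ c * size G ^ d)
theorem11 k 0<k = nbhdPolyProgram , c , d , λ G degenerate →
  let n = order G
      blocks , a , (t , run , t≤) , blocks-length , blocks-small , blocks-value =
        program-correct (rows G) (length-tabulate (encodeBits ∘ toList ∘ Graph.nbhd G)) {S n}
          {λ C → ∃[ A ] C ≡ common G A}
          (few-common G degenerate)
          (⊥ , sym (common-⊥ G))
          (All.tabulate⁺ λ v → λ { (A , refl) → A ∪ ⁅ v ⁆ ,
            trans (cong (common G A ∩_) (members-toList (Graph.nbhd G v))) (sym (common-∪ G A v)) })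
      instance
        -- For d > 0 the bound `c * n ^ d` vanishes at 0, so `PolyBounded` speaks of positive `n`
        -- only; here k < n provides this.
        n≢0 : NonZero n
        n≢0 = >-nonZero (≤-<-trans z≤n (Degenerate.k<n degenerate))
        B≢0 : NonZero (2 ^ suc n)
        B≢0 = m^n≢0 2 (suc n)
  in encodeList encodeBits blocks , t ,
     (encodeList encodeBits blocks ∷ᵛ a ,
      subst (λ x → Program.body nbhdPolyProgram , x ∷ᵛ Vec.replicate 15 nil ⇓ encodeList encodeBits blocks ∷ᵛ a [ t ])
            (sym (encodeList-tabulate (λ v → encodeBits (toList (Graph.nbhd G v))) (λ v → v))) run , refl) ,
     represents (2 ^ suc n) blocks blocks-length blocks-small (nbhdPoly-small G)
       (trans blocks-value (extensions-nbhdPoly G (2 ^ suc n))) ,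
     -- The time is bounded in terms of the order, which is at most the size.
     ≤-trans t≤ (≤-trans (bound n) (*-monoʳ-≤ c (^-monoˡ-≤ d (m≤m+n n _))))
  where
  S : ℕ → ℕ
  S n = suc n ^ k + suc n ^ k

  polynomial : PolyBounded (λ n → programTime n (suc n * suc n) (S n))
  polynomial = programTime-polyBounded (((constᵖ 1 +ᵖ idᵖ) ^ᵖ k) +ᵖ ((constᵖ 1 +ᵖ idᵖ) ^ᵖ k))

  c d : ℕ
  c = proj₁ polynomial
  d = proj₁ (proj₂ polynomial)

  bound : ∀ n → .{{NonZero n}} → programTime n (suc n * suc n) (S n) ≤ c * n ^ d
  bound = proj₂ (proj₂ polynomial)
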